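{- Let $G$ be an $n$-vertex connected graph containing at least one non-complete block, $n\geqslant 5$. Then $$\frac{Sz(G)}{W(G)}\geqslant 1+\frac{12}{n^3-19n+54}$$ with equality if and only if $G\cong B_n^{(1)}$.
   Context: All graphs are finite, simple, undirected. $W(G)=\sum_{\{u,v\}\subseteq V_G} d_G(u,v)$ is the Wiener index. For an edge $e=uv$, let $n_u(e)$ be the number of vertices strictly closer to $u$ than to $v$, and $n_v(e)$ the number strictly closer to $v$ than to $u$. The Szeged index is $Sz(G)=\sum_{e=uv\in E_G}n_u(e)n_v(e)$. A block is a maximal connected subgraph without a cut vertex. $K_4^-$ is $K_4$ minus one edge, and $B_n^{(1)}$ is the $n$-vertex graph obtained by identifying an end-vertex of the path $P_{n-3}$ (on $n-3$ vertices) with a degree-3 vertex of $K_4^-$. -}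

module Defs where

open import Data.Nat using (ℕ; zero; suc; _+_; _*_; _∸_; _^_; _<_; _≤_; _<ᵇ_)
open import Data.Bool using (Bool; true; false; _∧_; _∨_; not; if_then_else_)
open import Data.Fin using (Fin; toℕ)
import Data.Fin as F
import Data.Nat as N
open import Data.List using (List; map; allFin)
open import Data.Nat.ListAction using (sum)
open import Data.Product using (Σ; _×_; ∃; ∃-syntax; _,_)
open import Relation.Nullary using (¬_; ⌊_⌋)
open import Relation.Binary.PropositionalEquality using (_≡_; _≢_)
open import Function.Bundles using (_↔_; Inverse)

record Graph (n : ℕ) : Set where
  field
    adj     : Fin n → Fin n → Bool
    adj-sym : ∀ u v → adj u v ≡ adj v u
    irrefl  : ∀ u → adj u u ≡ false
open Graph public

data Walk {n : ℕ} (E : Fin n → Fin n → Bool) : Fin n → Fin n → Set where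
  here : ∀ {u} → Walk E u u
  step : ∀ {u w v} → E u w ≡ true → Walk E w v → Walk E u v

Connected : ∀ {n} → Graph n → Set
Connected {n} G = ∀ (u v : Fin n) → Walk (adj G) u v

anyFin : ∀ {n} → (Fin n → Bool) → Bool
anyFin {n} p = Data.List.foldr _∨_ false (map p (allFin n))
  where import Data.List

reach : ∀ {n} → (Fin n → Fin n → Bool) → ℕ → Fin n → Fin n → Bool
reach E zero u v = ⌊ u F.≟ v ⌋
reach E (suc k) u v = reach E k u v ∨ anyFin (λ w → E u w ∧ reach E k w v)

-- least k ≥ start, k ≤ start + fuel, with reach k u v; (never exceeded for connected graphs)
search : ∀ {n} → (Fin n → Fin n → Bool) → Fin n → Fin n → ℕ → ℕ → ℕ
search E u v k zero = k
search E u v k (suc fuel) = if reach E k u v then k else search E u v (suc k) fuel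

dist : ∀ {n} → Graph n → Fin n → Fin n → ℕ
dist {n} G u v = search (adj G) u v 0 n

Σv : ∀ n → (Fin n → ℕ) → ℕ
Σv n f = sum (map f (allFin n))

Σpairs : ∀ n → (Fin n → Fin n → ℕ) → ℕ
Σpairs n f = Σv n (λ u → Σv n (λ v → if toℕ u <ᵇ toℕ v then f u v else 0))

Wiener : ∀ {n} → Graph n → ℕ
Wiener {n} G = Σpairs n (dist G)

nClose : ∀ {n} → Graph n → Fin n → Fin n → ℕ
nClose {n} G u v = Σv n (λ w → if dist G w u <ᵇ dist G w v then 1 else 0)

Szeged : ∀ {n} → Graph n → ℕ
Szeged {n} G = Σpairs n (λ u v → if adj G u v then nClose G u v * nClose G v u else 0)

record Subgraph {n : ℕ} (G : Graph n) : Set where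
  field
    S    : Fin n → Bool
    E    : Fin n → Fin n → Bool
    E⊆G  : ∀ u v → E u v ≡ true → adj G u v ≡ true
    E⊆S  : ∀ u v → E u v ≡ true → (S u ≡ true) × (S v ≡ true)
    Esym : ∀ u v → E u v ≡ E v u
open Subgraph public

ConnectedSub : ∀ {n} {G : Graph n} → Subgraph G → Set
ConnectedSub H = ∀ u v → S H u ≡ true → S H v ≡ true → Walk (E H) u v

-- vertex set / edge relation of H - w (walks only need these)
delS : ∀ {n} {G : Graph n} → Subgraph G → Fin n → Fin n → Bool
delS H w u = S H u ∧ not ⌊ u F.≟ w ⌋

delE : ∀ {n} {G : Graph n} → Subgraph G → Fin n → Fin n → Fin n → Bool
delE H w u v = E H u v ∧ (not ⌊ u F.≟ w ⌋ ∧ not ⌊ v F.≟ w ⌋)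

CutVertex : ∀ {n} {G : Graph n} → Subgraph G → Fin n → Set
CutVertex H w = (S H w ≡ true) ×
  ¬ (∀ u v → delS H w u ≡ true → delS H w v ≡ true → Walk (delE H w) u v)

NoCutVertex : ∀ {n} {G : Graph n} → Subgraph G → Set
NoCutVertex H = ∀ w → ¬ CutVertex H w

_⊑_ : ∀ {n} {G : Graph n} → Subgraph G → Subgraph G → Set
H ⊑ H' = (∀ u → S H u ≡ true → S H' u ≡ true) × (∀ u v → E H u v ≡ true → E H' u v ≡ true)

Block : ∀ {n} (G : Graph n) → Subgraph G → Set
Block G H = ConnectedSub H × NoCutVertex H ×
  (∀ (H' : Subgraph G) → H ⊑ H' → ConnectedSub H' → NoCutVertex H' → H' ⊑ H)

NonComplete : ∀ {n} {G : Graph n} → Subgraph G → Set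
NonComplete {n} H = ∃[ u ] ∃[ v ] (S H u ≡ true) × (S H v ≡ true) × (u ≢ v) × (E H u v ≡ false)

-- The graph B_n^(1): K4^- on {0,1,2,3} (missing edge 23; 0,1 have degree 3),
-- path 0 - 4 - 5 - ... - (n-1) attached at vertex 0 (path on n-3 vertices).

bE : ℕ → ℕ → Bool
bE 0 1 = true
bE 0 2 = true
bE 0 3 = true
bE 0 4 = true
bE 1 2 = true
bE 1 3 = true
bE (suc (suc (suc (suc k)))) b = ⌊ b N.≟ 5 + k ⌋
bE _ _ = false

Badj : ∀ n → Fin n → Fin n → Bool
Badj n u v = bE (toℕ u) (toℕ v) ∨ bE (toℕ v) (toℕ u)

_≅_ : ∀ {n} → Graph n → (Fin n → Fin n → Bool) → Set
_≅_ {n} G A = Σ (Fin n ↔ Fin n) λ σ → ∀ u v → adj G u v ≡ A (Inverse.to σ u) (Inverse.to σ v)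

-- denominator n^3 - 19n + 54 (positive for every n)
den : ℕ → ℕ
den n = n ^ 3 + 54 ∸ 19 * n

{-# OPTIONS --safe #-}
-- Call an edge separating for a pair {x,y} if x is strictly closer to one end and y to the other.
-- Counting in two ways, Sz is the sum over all pairs of the number of separating edges. The edges of
-- a geodesic from x to y separate {x,y}, so Sz - W is a sum of nonnegative excesses of the pairs.
--
-- In a graph with unique geodesics, a block that is not complete yields an edge ww' whose ends are at
-- equal distance from some b and are reached from b through nonadjacent neighbours p, p' of b; this
-- gives three pairs of positive excess. Otherwise a closest pair with two geodesics either is at
-- distance at least 3 and has excess at least 3, or is at distance 2 and has excess at least 2. So
-- Sz - W ≥ 3, unless Sz - W = 2 and two vertices x, y of degree 2 have the same pair of adjacent
-- neighbours.
--
-- If Sz - W ≥ 3, the bound W ≤ (n³ - n)/6 suffices. In the remaining case 6W ≤ n³ - 19n + 54: order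
-- the other vertices so that each one after the first has an earlier neighbour, and bound the
-- distances from each vertex to the earlier ones. Equality forces all the levels around x to be
-- single vertices.
module Submission where

open import Defs
open import Data.Bool using (Bool; true; false; _∧_; _∨_; not; if_then_else_)
import Data.Bool as B
open import Data.Bool.Properties using (∧-comm; ∨-comm; ∨-zeroʳ)
open import Data.Empty using (⊥; ⊥-elim)
open import Data.Fin using (Fin; zero; suc; toℕ; fromℕ<)
import Data.Fin as F
import Data.Fin.Properties as Fₚ
open import Data.List using (List; []; _∷_; _++_; map; allFin; length; cartesianProduct; tabulate; foldr)
open import Data.List.Properties using (map-cong; map-∘; map-++; length-map; length-++; map-tabulate; length-tabulate)
open import Data.List.Membership.Propositional using (_∈_; _∉_)
open import Data.List.Membership.Propositional.Properties using (∈-allFin; ∈-map⁻; ∈-++⁺ˡ; ∈-++⁺ʳ; ∈-++⁻; ∈-cartesianProduct⁺; ∈-∃++)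
open import Data.List.Relation.Binary.Subset.Propositional using (_⊆_)
open import Data.List.Relation.Binary.Permutation.Propositional using (↭⇒↭ₛ)
import Data.List.Relation.Binary.Permutation.Propositional.Properties as Permₚ
import Data.List.Relation.Binary.Permutation.Setoid.Properties as Permₛₚ
open import Data.List.Relation.Unary.All using (All; []; _∷_)
import Data.List.Relation.Unary.All as All
import Data.List.Relation.Unary.All.Properties as Allₚ
open import Data.List.Relation.Unary.AllPairs using (AllPairs; []; _∷_)
import Data.List.Relation.Unary.AllPairs as AllPairs
open import Data.List.Relation.Unary.Any using (here; there; any?)
open import Data.List.Relation.Unary.Unique.Propositional using (Unique)
import Data.List.Relation.Unary.Unique.Propositional.Properties as Uniqueₚ
open import Data.Nat
open import Data.Nat.ListAction using (sum)
open import Data.Nat.ListAction.Properties using (sum-++)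
open import Data.Nat.Properties
open import Data.Nat.Induction using (<-rec)
open import Data.Nat.Tactic.RingSolver using (solve-∀)
open import Data.Product using (_×_; ∃-syntax; ∃₂; _,_; proj₁; proj₂; swap; map₂)
import Data.Sum as Sum
open import Data.Sum using (_⊎_; inj₁; inj₂; [_,_]′)
open import Function using (_∘_; case_of_)
open import Function.Bundles using (_⇔_; _↔_; Inverse; mk⇔; mk↔ₛ′)
open import Relation.Nullary using (¬_; Dec; yes; no; ⌊_⌋; ¬?; _×-dec_)
open import Relation.Nullary.Decidable using (dec-true; dec-false; decidable-stable)
open import Relation.Binary.Definitions using (tri<; tri≈; tri>)
open import Relation.Binary.PropositionalEquality

-- Finite sums

-- The constants come from `B_n^(1)`: there Sz - W = 2 and 6W = n³ - 19n + 54, so that Sz/W = 1 +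
-- 2/W is the claimed bound. An excess of 3 asks only for 4W < n³ - 19n + 54. The bound by the
-- Wiener index of a path gives this, narrowly for n = 5, where it compares 80 with 84. With an
-- excess of 2 the same bound fails: n³ - n exceeds n³ - 19n + 54 by 18n - 54. This is why the place
-- of the excess has to be pinned down and W bounded again for such graphs. Excess is summed over
-- ordered pairs, so `total` is 2(Sz - W), and the excesses 3 and 2 appear as `6 ≤ total` and
-- `4 ≤ total`. Distances are used only through properties that characterise them. Thus `dist`,
-- which is a search with fuel, and the explicit distances of `B_n^(1)` are treated alike. The
-- Wiener bounds delete no vertices and follow no paths: they use only that a distance function
-- changes by at most one along an edge.

∑ : ∀ {A : Set} → List A → (A → ℕ) → ℕ
∑ xs f = sum (map f xs)

[_]ᵇ : Bool → ℕ
[ b ]ᵇ = if b then 1 else 0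

module _ {A : Set} where

  ∑-cong : ∀ (xs : List A) {f g} → (∀ x → f x ≡ g x) → ∑ xs f ≡ ∑ xs g
  ∑-cong xs eq = cong sum (map-cong eq xs)

  ∑-mono : ∀ (xs : List A) {f g} → (∀ x → f x ≤ g x) → ∑ xs f ≤ ∑ xs g
  ∑-mono []       le = z≤n
  ∑-mono (x ∷ xs) le = +-mono-≤ (le x) (∑-mono xs le)

  ∑-zero : ∀ (xs : List A) → ∑ xs (λ _ → 0) ≡ 0
  ∑-zero []       = refl
  ∑-zero (_ ∷ xs) = ∑-zero xs

  ∑-+ : ∀ (xs : List A) f g → ∑ xs (λ x → f x + g x) ≡ ∑ xs f + ∑ xs g
  ∑-+ []       f g = refl
  ∑-+ (x ∷ xs) f g rewrite ∑-+ xs f g = lemma (f x) (g x) (∑ xs f) (∑ xs g)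
    where
    lemma : ∀ a b c d → a + b + (c + d) ≡ a + c + (b + d)
    lemma = solve-∀

  ∑-*ʳ : ∀ (xs : List A) f c → ∑ xs (λ x → f x * c) ≡ ∑ xs f * c
  ∑-*ʳ []       f c = refl
  ∑-*ʳ (x ∷ xs) f c rewrite ∑-*ʳ xs f c = sym (*-distribʳ-+ c (f x) _)

  ∑-++ : ∀ (xs ys : List A) f → ∑ (xs ++ ys) f ≡ ∑ xs f + ∑ ys f
  ∑-++ xs ys f = trans (cong sum (map-++ f xs ys)) (sum-++ (map f xs) _)

  ∑-map : ∀ {B : Set} (g : A → B) xs f → ∑ (map g xs) f ≡ ∑ xs (f ∘ g)
  ∑-map g xs f = cong sum (sym (map-∘ xs))

  ∑-const : ∀ (xs : List A) c → ∑ xs (λ _ → c) ≡ length xs * c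
  ∑-const []       c = refl
  ∑-const (_ ∷ xs) c = cong (c +_) (∑-const xs c)

  -- Removing one occurrence of `y` from `xs` keeps the rest of `ys` inside, because `y` does not
  -- recur there. All re-indexing of sums rests on this.
  ∑-mono-⊆ : ∀ {xs ys : List A} f → Unique ys → ys ⊆ xs → ∑ ys f ≤ ∑ xs f
  ∑-mono-⊆ {xs} {[]} f _ _ = z≤n
  ∑-mono-⊆ {xs} {y ∷ ys} f (y∉ ∷ uniq) sub
    with as , bs , refl ← ∈-∃++ (sub (here refl)) = begin
      f y + ∑ ys f                ≤⟨ +-monoʳ-≤ (f y) (∑-mono-⊆ f uniq sub′) ⟩
      f y + ∑ (as ++ bs) f        ≡⟨ cong (f y +_) (∑-++ as bs f) ⟩
      f y + (∑ as f + ∑ bs f)     ≡⟨ lemma (f y) (∑ as f) _ ⟩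
      ∑ as f + (f y + ∑ bs f)     ≡⟨ ∑-++ as (y ∷ bs) f ⟨
      ∑ (as ++ y ∷ bs) f          ∎
    where
    open ≤-Reasoning
    lemma : ∀ a b c → a + (b + c) ≡ b + (a + c)
    lemma = solve-∀
    sub′ : ys ⊆ as ++ bs
    sub′ z∈ with ∈-++⁻ as (sub (there z∈))
    ... | inj₁ z∈as          = ∈-++⁺ˡ z∈as
    ... | inj₂ (here refl)   = ⊥-elim (All.lookup y∉ z∈ refl)
    ... | inj₂ (there z∈bs)  = ∈-++⁺ʳ as z∈bs

  ∑-cong-≐ : ∀ {xs ys : List A} f → Unique xs → Unique ys → xs ⊆ ys → ys ⊆ xs → ∑ xs f ≡ ∑ ys f
  ∑-cong-≐ f ux uy xy yx = ≤-antisym (∑-mono-⊆ f ux xy) (∑-mono-⊆ f uy yx)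

  length≡∑1 : ∀ (xs : List A) → length xs ≡ ∑ xs (λ _ → 1)
  length≡∑1 xs = sym (trans (∑-const xs 1) (*-identityʳ _))

module _ {A B : Set} where

  ∑-comm : ∀ (xs : List A) (ys : List B) (f : A → B → ℕ) →
           ∑ xs (λ x → ∑ ys (f x)) ≡ ∑ ys (λ y → ∑ xs (λ x → f x y))
  ∑-comm []       ys f = sym (∑-zero ys)
  ∑-comm (x ∷ xs) ys f = trans (cong (∑ ys (f x) +_) (∑-comm xs ys f)) (sym (∑-+ ys (f x) (λ y → ∑ xs (λ x → f x y))))

  ∑-cartesianProduct : ∀ (xs : List A) (ys : List B) (f : A × B → ℕ) →
                       ∑ (cartesianProduct xs ys) f ≡ ∑ xs (λ x → ∑ ys (λ y → f (x , y)))
  ∑-cartesianProduct []       ys f = refl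
  ∑-cartesianProduct (x ∷ xs) ys f =
    trans (∑-++ (map (x ,_) ys) (cartesianProduct xs ys) f)
          (cong₂ _+_ (∑-map (x ,_) ys f) (∑-cartesianProduct xs ys f))

Unique-length : ∀ {n} {xs : List (Fin n)} → Unique xs → length xs ≤ n
Unique-length {n} {xs} uniq = begin
  length xs                    ≡⟨ length≡∑1 xs ⟩
  ∑ xs (λ _ → 1)               ≤⟨ ∑-mono-⊆ _ uniq (λ {x} _ → ∈-allFin x) ⟩
  ∑ (allFin n) (λ _ → 1)       ≡⟨ length≡∑1 (allFin n) ⟨
  length (allFin n)            ≡⟨ length-tabulate {n = n} (λ x → x) ⟩
  n                            ∎
  where open ≤-Reasoning

_∈?_ : ∀ {n} (x : Fin n) xs → Dec (x ∈ xs)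
x ∈? xs = any? (x F.≟_) xs

Unique-complete : ∀ {n} {xs : List (Fin n)} → Unique xs → n ≤ length xs → ∀ x → x ∈ xs
Unique-complete {n} {xs} uniq len x with x ∈? xs
... | yes x∈ = x∈
... | no  x∉ = ⊥-elim (<-irrefl refl (≤-trans (s≤s len) (Unique-length (Allₚ.¬Any⇒All¬ _ x∉ ∷ uniq))))

double-injective : ∀ {a b} → a + a ≡ b + b → a ≡ b
double-injective {a} {b} eq = *-cancelˡ-≡ a b 2
  (trans (cong (a +_) (+-identityʳ a)) (trans eq (cong (b +_) (sym (+-identityʳ b)))))

module _ {n : ℕ} where

  Σv-complete : ∀ {xs : List (Fin n)} f → Unique xs → (∀ x → x ∈ xs) → Σv n f ≡ ∑ xs f
  Σv-complete f uniq all = ∑-cong-≐ f (Uniqueₚ.allFin⁺ n) uniq (λ {x} _ → all x) (λ {x} _ → ∈-allFin x)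

  Σv-injective : ∀ (σ : Fin n → Fin n) → (∀ {x y} → σ x ≡ σ y → x ≡ y) → ∀ f → Σv n (f ∘ σ) ≡ Σv n f
  Σv-injective σ inj f = trans (sym (∑-map σ (allFin n) f)) (sym (Σv-complete f uniq complete))
    where
    uniq : Unique (map σ (allFin n))
    uniq = Uniqueₚ.map⁺ inj (Uniqueₚ.allFin⁺ n)
    complete : ∀ x → x ∈ map σ (allFin n)
    complete = Unique-complete uniq (≤-reflexive (sym (trans (length-map σ (allFin n)) (length-tabulate {n = n} (λ x → x)))))

  ΣΣ : (Fin n → Fin n → ℕ) → ℕ
  ΣΣ f = Σv n (λ u → Σv n (f u))

  ΣΣ-cong : ∀ {f g} → (∀ u v → f u v ≡ g u v) → ΣΣ f ≡ ΣΣ g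
  ΣΣ-cong eq = ∑-cong (allFin n) (λ u → ∑-cong (allFin n) (eq u))

  Σpairs-cong : ∀ {f g : Fin n → Fin n → ℕ} → (∀ u v → f u v ≡ g u v) → Σpairs n f ≡ Σpairs n g
  Σpairs-cong eq = ΣΣ-cong (λ u v → cong (λ k → if toℕ u <ᵇ toℕ v then k else 0) (eq u v))

  ΣΣ-+ : ∀ f g → ΣΣ (λ u v → f u v + g u v) ≡ ΣΣ f + ΣΣ g
  ΣΣ-+ f g = trans (∑-cong (allFin n) (λ u → ∑-+ (allFin n) (f u) (g u))) (∑-+ (allFin n) _ _)

  -- Ordered double sums are easier to re-index than the sums over u < v of the definitions.
  ΣΣ-double : ∀ f → (∀ u v → f u v ≡ f v u) → (∀ u → f u u ≡ 0) → ΣΣ f ≡ Σpairs n f + Σpairs n f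
  ΣΣ-double f fsym fdiag = begin
    ΣΣ f                                                  ≡⟨ ΣΣ-cong split ⟩
    ΣΣ (λ u v → f< u v + f< v u)                          ≡⟨ ΣΣ-+ f< (λ u v → f< v u) ⟩
    Σpairs n f + ΣΣ (λ u v → f< v u)                      ≡⟨ cong (Σpairs n f +_) (∑-comm (allFin n) (allFin n) (λ u v → f< v u)) ⟩
    Σpairs n f + Σpairs n f                               ∎
    where
    open ≡-Reasoning
    f< : Fin n → Fin n → ℕ
    f< u v = if toℕ u <ᵇ toℕ v then f u v else 0
    split : ∀ u v → f u v ≡ f< u v + f< v u
    split u v with <-cmp (toℕ u) (toℕ v)
    ... | tri< lt _ ngt rewrite dec-true (toℕ u <? toℕ v) lt | dec-false (toℕ v <? toℕ u) ngt = sym (+-identityʳ _)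
    ... | tri≈ nlt eq ngt rewrite dec-false (toℕ u <? toℕ v) nlt | dec-false (toℕ v <? toℕ u) ngt
        | Fₚ.toℕ-injective eq = fdiag v
    ... | tri> nlt _ gt rewrite dec-false (toℕ u <? toℕ v) nlt | dec-true (toℕ v <? toℕ u) gt = fsym u v

  -- Follows the order of a list, so that putting a new vertex in front of a chain adds exactly one
  -- row of distances.
  pairSum : (Fin n → Fin n → ℕ) → List (Fin n) → ℕ
  pairSum f []       = 0
  pairSum f (x ∷ xs) = ∑ xs (f x) + pairSum f xs

  ∑∑-pairSum : ∀ f → (∀ u v → f u v ≡ f v u) → (∀ u → f u u ≡ 0) → ∀ xs →
               ∑ xs (λ u → ∑ xs (f u)) ≡ pairSum f xs + pairSum f xs
  ∑∑-pairSum f fsym fdiag []       = refl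
  ∑∑-pairSum f fsym fdiag (x ∷ xs) = begin
    f x x + ∑ xs (f x) + ∑ xs (λ u → f u x + ∑ xs (f u))
      ≡⟨ cong₂ _+_ (cong (_+ ∑ xs (f x)) (fdiag x)) (∑-+ xs (λ u → f u x) (λ u → ∑ xs (f u))) ⟩
    ∑ xs (f x) + (∑ xs (λ u → f u x) + ∑ xs (λ u → ∑ xs (f u)))
      ≡⟨ cong₂ (λ a b → ∑ xs (f x) + (a + b)) (∑-cong xs (λ u → fsym u x)) (∑∑-pairSum f fsym fdiag xs) ⟩
    ∑ xs (f x) + (∑ xs (f x) + (pairSum f xs + pairSum f xs))
      ≡⟨ lemma (∑ xs (f x)) (pairSum f xs) ⟩
    pairSum f (x ∷ xs) + pairSum f (x ∷ xs) ∎
    where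
    open ≡-Reasoning
    lemma : ∀ a b → a + (a + (b + b)) ≡ a + b + (a + b)
    lemma = solve-∀

  Σpairs≡pairSum : ∀ f → (∀ u v → f u v ≡ f v u) → (∀ u → f u u ≡ 0) →
                   ∀ {xs} → Unique xs → (∀ x → x ∈ xs) → Σpairs n f ≡ pairSum f xs
  Σpairs≡pairSum f fsym fdiag {xs} uniq all = double-injective (begin
    Σpairs n f + Σpairs n f            ≡⟨ ΣΣ-double f fsym fdiag ⟨
    ΣΣ f                               ≡⟨ Σv-complete _ uniq all ⟩
    ∑ xs (λ u → Σv n (f u))            ≡⟨ ∑-cong xs (λ u → Σv-complete (f u) uniq all) ⟩
    ∑ xs (λ u → ∑ xs (f u))            ≡⟨ ∑∑-pairSum f fsym fdiag xs ⟩
    pairSum f xs + pairSum f xs        ∎)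
    where open ≡-Reasoning

-- Distances and chains of vertices

private variable
  n : ℕ
  G : Graph n
  base vs : List (Fin n)

-- `d-step` bounds `d` from above along every edge, and `d-next` provides an edge on which the bound
-- is attained; with the zero set this determines `d`. Being valued in ℕ, such a `d` exists only on
-- connected graphs.
record IsDistance (G : Graph n) (d : Fin n → Fin n → ℕ) : Set where
  field
    d-refl : ∀ u → d u u ≡ 0
    d-eq   : ∀ {u v} → d u v ≡ 0 → u ≡ v
    d-step : ∀ {u w} → adj G u w ≡ true → ∀ v → d u v ≤ suc (d w v)
    d-next : ∀ {u v k} → d u v ≡ suc k → ∃[ w ] adj G u w ≡ true × d w v ≡ k

module Distance {G : Graph n} {d : Fin n → Fin n → ℕ} (isDistance : IsDistance G d) where
  open IsDistance isDistance public

  infix 4 _~_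
  _~_ : Fin n → Fin n → Set
  u ~ v = adj G u v ≡ true

  _~?_ : ∀ u v → Dec (u ~ v)
  u ~? v = adj G u v B.≟ true

  ~-sym : ∀ {u v} → u ~ v → v ~ u
  ~-sym {u} {v} uv = trans (adj-sym G v u) uv

  ~-irrefl : ∀ {u} → ¬ u ~ u
  ~-irrefl {u} uu with () ← trans (sym (irrefl G u)) uu

  d-adj≤ : ∀ {u v} → u ~ v → d u v ≤ 1
  d-adj≤ {v = v} uv = subst (λ k → d _ v ≤ suc k) (d-refl v) (d-step uv v)

  d-tri : ∀ u w v → d u v ≤ d u w + d w v
  d-tri u w v = go (d u w) u refl
    where
    go : ∀ k u → d u w ≡ k → d u v ≤ k + d w v
    go zero    u eq rewrite d-eq eq = ≤-refl
    go (suc k) u eq with u′ , uu′ , eq′ ← d-next eq = ≤-trans (d-step uu′ v) (s≤s (go k u′ eq′))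

  d-sym : ∀ u v → d u v ≡ d v u
  d-sym u v = ≤-antisym (go (d v u) v u refl) (go (d u v) u v refl)
    where
    go : ∀ k u v → d u v ≡ k → d v u ≤ k
    go zero    u v eq rewrite d-eq eq = ≤-reflexive (d-refl v)
    go (suc k) u v eq with u′ , uu′ , eq′ ← d-next eq = begin
      d v u            ≤⟨ d-tri v u′ u ⟩
      d v u′ + d u′ u  ≤⟨ +-mono-≤ (go k u′ v eq′) (d-adj≤ (~-sym uu′)) ⟩
      k + 1            ≡⟨ +-comm k 1 ⟩
      suc k            ∎
      where open ≤-Reasoning

  d-stepʳ : ∀ {v w} u → v ~ w → d u w ≤ suc (d u v)
  d-stepʳ {v} {w} u vw rewrite d-sym u w | d-sym u v = d-step (~-sym vw) u

  d-prev : ∀ {u v k} → d u v ≡ suc k → ∃[ w ] w ~ v × d u w ≡ k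
  d-prev {u} {v} eq with w , vw , eq′ ← d-next (trans (d-sym v u) eq) = w , ~-sym vw , trans (d-sym u w) eq′

  d-adj : ∀ {u v} → u ~ v → d u v ≡ 1
  d-adj {u} {v} uv with d u v in eq | d-adj≤ uv
  ... | zero        | _ with refl ← d-eq eq = ⊥-elim (~-irrefl uv)
  ... | suc zero    | _ = refl
  ... | suc (suc _) | s≤s ()

  adj-d : ∀ {u v} → d u v ≡ 1 → u ~ v
  adj-d {u} eq with w , uw , eq′ ← d-next eq with refl ← d-eq eq′ = uw

  d≥2 : ∀ {u v} → u ≢ v → ¬ u ~ v → 2 ≤ d u v
  d≥2 {u} {v} u≢v u≁v with d u v in eq
  ... | zero        = ⊥-elim (u≢v (d-eq eq))
  ... | suc zero    = ⊥-elim (u≁v (adj-d eq))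
  ... | suc (suc _) = s≤s (s≤s z≤n)

  d≡2 : ∀ {u w v} → u ≢ v → ¬ u ~ v → u ~ w → w ~ v → d u v ≡ 2
  d≡2 u≢v u≁v uw wv = ≤-antisym (≤-trans (d-step uw _) (s≤s (d-adj≤ wv))) (d≥2 u≢v u≁v)

IsDistance-unique : ∀ {d d′} → IsDistance G d → IsDistance G d′ → ∀ u v → d u v ≡ d′ u v
IsDistance-unique {n} {G} D D′ u v = ≤-antisym (go D D′ _ u refl) (go D′ D _ u refl)
  where
  go : ∀ {d d′} → IsDistance G d → IsDistance G d′ → ∀ k u → d′ u v ≡ k → d u v ≤ k
  go D D′ zero    u eq with refl ← IsDistance.d-eq D′ eq = ≤-reflexive (IsDistance.d-refl D u)
  go D D′ (suc k) u eq with w , uw , eq′ ← IsDistance.d-next D′ eq =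
    ≤-trans (IsDistance.d-step D uw v) (s≤s (go D D′ k w eq′))

-- An order of exploration, newest vertex first: each vertex outside `base` has a neighbour among
-- the older ones. The vertices of `base` need not be adjacent.
data Chain (G : Graph n) (base : List (Fin n)) : List (Fin n) → Set where
  start : Chain G base base
  grow  : ∀ {v u vs} → u ∈ vs → adj G v u ≡ true → Chain G base vs → Chain G base (v ∷ vs)

Chain-⊇ : Chain G base vs → base ⊆ vs
Chain-⊇ start         x∈ = x∈
Chain-⊇ (grow _ _ ch) x∈ = there (Chain-⊇ ch x∈)

escape : ∀ (E : Fin n → Fin n → Bool) {u v} L → Walk E u v → u ∈ L → v ∉ L → ∃₂ λ p q → p ∈ L × q ∉ L × E p q ≡ true
escape E L here u∈ v∉ = ⊥-elim (v∉ u∈)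
escape E L (step {w = w} uw walk) u∈ v∉ with w ∈? L
... | yes w∈ = escape E L walk w∈ v∉
... | no  w∉ = _ , w , u∈ , w∉ , uw

-- The vertices of X are left out of the chain, which must therefore not need them to grow.
Chain-complete : Connected G → ∀ {r} → r ∈ base → ∀ X → (∀ {u v} → u ∈ X → adj G u v ≡ true → v ∈ base) →
                 Unique (base ++ X) →
                 ∃[ vs ] Chain G base vs × Unique (vs ++ X) × (∀ x → x ∈ vs ++ X)
Chain-complete {n} {G} {base} conn {r} r∈ X closed uniq = go n start uniq (m≤m+n n _)
  where
  go : ∀ fuel {vs} → Chain G base vs → Unique (vs ++ X) → n ≤ fuel + length (vs ++ X) →
       ∃[ vs ] Chain G base vs × Unique (vs ++ X) × (∀ x → x ∈ vs ++ X)
  go zero ch uniq len = _ , ch , uniq , Unique-complete uniq len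
  go (suc fuel) {vs} ch uniq len with Fₚ.all? (λ x → x ∈? (vs ++ X))
  ... | yes all = vs , ch , uniq , all
  ... | no ¬all with x , x∉ ← Fₚ.¬∀⟶∃¬ n _ (λ x → x ∈? (vs ++ X)) ¬all
    with p , q , p∈ , q∉ , pq ← escape (adj G) (vs ++ X) (conn r x) (∈-++⁺ˡ (Chain-⊇ ch r∈)) x∉
    with ∈-++⁻ vs p∈
  ... | inj₁ p∈vs = go fuel (grow p∈vs (trans (adj-sym G q p) pq) ch) (Allₚ.¬Any⇒All¬ _ q∉ ∷ uniq)
                      (≤-trans len (≤-reflexive (sym (+-suc fuel _))))
  ... | inj₂ p∈X  = ⊥-elim (q∉ (∈-++⁺ˡ (Chain-⊇ ch (closed p∈X pq))))

Lipschitz : Graph n → (Fin n → ℕ) → Set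
Lipschitz G f = ∀ {u w} → adj G u w ≡ true → f u ≤ suc (f w)

-- Each new vertex is adjacent to an older one and so widens the range of `f` by at most one.
Chain-diameter : ∀ {r} → Chain G (r ∷ []) vs → ∀ {f} → Lipschitz G f →
                 ∀ {u v} → u ∈ vs → v ∈ vs → f v < f u + length vs
Chain-diameter start {f} lip {u} (here refl) (here refl) = ≤-reflexive (+-comm 1 (f u))
Chain-diameter {G = G} (grow {w} {w′} {vs} w′∈ ww′ ch) {f} lip {u} {v} u∈ v∈ = lemma u∈ v∈
  where
  open ≤-Reasoning
  lemma : u ∈ w ∷ vs → v ∈ w ∷ vs → f v < f u + suc (length vs)
  lemma (here refl) (here refl) = m<m+n (f u) (s≤s z≤n)
  lemma (here refl) (there v∈) = begin-strict
    f v                        <⟨ Chain-diameter ch lip w′∈ v∈ ⟩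
    f w′ + length vs           ≤⟨ +-monoˡ-≤ _ (lip (trans (adj-sym G w′ w) ww′)) ⟩
    suc (f w) + length vs      ≡⟨ +-suc (f w) _ ⟨
    f w + suc (length vs)      ∎
  lemma (there u∈) (here refl) = begin-strict
    f w                        ≤⟨ lip ww′ ⟩
    suc (f w′)                 ≤⟨ Chain-diameter ch lip u∈ w′∈ ⟩
    f u + length vs            <⟨ +-monoʳ-< (f u) ≤-refl ⟩
    f u + suc (length vs)      ∎
  lemma (there u∈) (there v∈) = begin-strict
    f v                        <⟨ Chain-diameter ch lip u∈ v∈ ⟩
    f u + length vs            <⟨ +-monoʳ-< (f u) ≤-refl ⟩
    f u + suc (length vs)      ∎

-- Reflection of Booleans, and `dist` as a distance

∨-introʳ : ∀ a {b} → b ≡ true → a ∨ b ≡ true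
∨-introʳ a refl = ∨-zeroʳ a

∨-elim : ∀ a {b} → a ∨ b ≡ true → a ≡ true ⊎ b ≡ true
∨-elim true  _  = inj₁ refl
∨-elim false eq = inj₂ eq

∧-elim : ∀ a {b} → a ∧ b ≡ true → a ≡ true × b ≡ true
∧-elim true eq = refl , eq

∧-intro : ∀ {a b} → a ≡ true → b ≡ true → a ∧ b ≡ true
∧-intro refl refl = refl

does-elim : ∀ {P : Set} (P? : Dec P) → ⌊ P? ⌋ ≡ true → P
does-elim (yes p) _ = p

does-intro : ∀ {P : Set} (P? : Dec P) → P → ⌊ P? ⌋ ≡ true
does-intro (yes _) _ = refl
does-intro (no ¬p) p = ⊥-elim (¬p p)

not-does-elim : ∀ {P : Set} (P? : Dec P) → not ⌊ P? ⌋ ≡ true → ¬ P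
not-does-elim (no ¬p) _ = ¬p

≢true⇒≡false : ∀ {b} → b ≢ true → b ≡ false
≢true⇒≡false {true}  ne = ⊥-elim (ne refl)
≢true⇒≡false {false} ne = refl

anyFin-intro : ∀ (p : Fin n → Bool) w → p w ≡ true → anyFin p ≡ true
anyFin-intro p w pw = go (allFin _) (∈-allFin w)
  where
  go : ∀ xs → w ∈ xs → foldr _∨_ false (map p xs) ≡ true
  go (x ∷ xs) (here refl) rewrite pw = refl
  go (x ∷ xs) (there w∈)  = ∨-introʳ (p x) (go xs w∈)

anyFin-elim : ∀ (p : Fin n → Bool) → anyFin p ≡ true → ∃[ w ] p w ≡ true
anyFin-elim p = go (allFin _)
  where
  go : ∀ xs → foldr _∨_ false (map p xs) ≡ true → ∃[ w ] p w ≡ true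
  go (x ∷ xs) eq with ∨-elim (p x) eq
  ... | inj₁ px = x , px
  ... | inj₂ r  = go xs r

module _ (G : Graph n) (conn : Connected G) where

  private
    R : ℕ → Fin n → Fin n → Set
    R k u v = reach (adj G) k u v ≡ true

    Least : ℕ → Fin n → Fin n → Set
    Least k u v = R k u v × (∀ j → R j u v → k ≤ j)

    R-step : ∀ k {u w} v → adj G u w ≡ true → R k w v → R (suc k) u v
    R-step k {u} {w} v uw r = ∨-introʳ (reach (adj G) k u v) (anyFin-intro _ w (∧-intro uw r))

    walk-reach : ∀ {u v} → Walk (adj G) u v → ∃[ k ] R k u v
    walk-reach (here {u})     = 0 , does-intro (u F.≟ u) refl
    walk-reach (step uw walk) with k , r ← walk-reach walk = suc k , R-step k _ uw r

    R-mono : ∀ {j k u v} → j ≤′ k → R j u v → R k u v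
    R-mono ≤′-refl        r = r
    R-mono {j} {suc k} {u} {v} (≤′-step j≤) r rewrite R-mono j≤ r = refl

    least : ∀ k {u v} → R k u v → ∃[ k ] Least k u v
    least zero r = 0 , r , λ _ _ → z≤n
    least (suc k) {u} {v} r with reach (adj G) k u v B.≟ true
    ... | yes r′ = least k r′
    ... | no ¬r′ = suc k , r , λ j rj → ≰⇒> (λ j≤k → ¬r′ (R-mono (≤⇒≤′ j≤k) rj))

    least-reach : ∀ u v → ∃[ k ] Least k u v
    least-reach u v = let k , r = walk-reach (conn u v) in least k r

    δ : Fin n → Fin n → ℕ
    δ u v = proj₁ (least-reach u v)

    δ-least : ∀ u v → Least (δ u v) u v
    δ-least u v = proj₂ (least-reach u v)

    δ-isDistance : IsDistance G δ
    δ-isDistance = record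
      { d-refl = λ u → n≤0⇒n≡0 (proj₂ (δ-least u u) 0 (does-intro (u F.≟ u) refl))
      ; d-eq   = λ {u} {v} eq → does-elim (u F.≟ v) (subst (λ k → R k u v) eq (proj₁ (δ-least u v)))
      ; d-step = step-δ
      ; d-next = next
      }
      where
      step-δ : ∀ {u w} → adj G u w ≡ true → ∀ v → δ u v ≤ suc (δ w v)
      step-δ {u} {w} uw v = proj₂ (δ-least u v) _ (R-step (δ w v) v uw (proj₁ (δ-least w v)))
      next : ∀ {u v k} → δ u v ≡ suc k → ∃[ w ] adj G u w ≡ true × δ w v ≡ k
      next {u} {v} {k} eq
        with ∨-elim (reach (adj G) k u v) (subst (λ k → R k u v) eq (proj₁ (δ-least u v)))
      ... | inj₁ r = ⊥-elim (<-irrefl refl (subst (_≤ k) eq (proj₂ (δ-least u v) k r)))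
      ... | inj₂ r with w , e ← anyFin-elim _ r with uw , r′ ← ∧-elim (adj G u w) e =
        w , uw , ≤-antisym (proj₂ (δ-least w v) k r′) (s≤s⁻¹ (subst (_≤ suc (δ w v)) eq (step-δ uw v)))

    -- The fuel n given to search in dist suffices because a chain through all vertices bounds the diameter.
    δ<n : ∀ u v → δ u v < n
    δ<n u v
      with vs , ch , uniq , all ← Chain-complete {G = G} {base = u ∷ []} conn (here refl) [] (λ ()) ([] ∷ []) =
      begin-strict
        δ u v                       ≡⟨ d-sym u v ⟩
        δ v u                       <⟨ Chain-diameter ch {λ x → δ x u} (λ xw → d-step xw u) (all′ u) (all′ v) ⟩
        δ u u + length vs           ≡⟨ cong (_+ length vs) (d-refl u) ⟩
        length vs                   ≤⟨ m≤m+n _ _ ⟩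
        length vs + 0               ≡⟨ length-++ vs {[]} ⟨
        length (vs ++ [])           ≤⟨ Unique-length uniq ⟩
        n                           ∎
      where
      open ≤-Reasoning
      open Distance δ-isDistance
      all′ : ∀ x → x ∈ vs
      all′ x with inj₁ x∈ ← ∈-++⁻ vs (all x) = x∈

    -- The invariant `j ≤ k ≤ j + fuel` keeps the least value within the range still to be searched.
    search-least : ∀ {u v k} fuel j → Least k u v → j ≤ k → k ≤ j + fuel → search (adj G) u v j fuel ≡ k
    search-least zero j l j≤k k≤ = ≤-antisym j≤k (subst (_ ≤_) (+-identityʳ j) k≤)
    search-least {u} {v} {k} (suc fuel) j l j≤k k≤ with reach (adj G) j u v in eq
    ... | true  = ≤-antisym j≤k (proj₂ l j eq)
    ... | false with m≤n⇒m<n∨m≡n j≤k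
    ... | inj₁ j<k = search-least fuel (suc j) l j<k (subst (k ≤_) (+-suc j fuel) k≤)
    ... | inj₂ refl with () ← trans (sym eq) (proj₁ l)

    dist≡δ : ∀ u v → dist G u v ≡ δ u v
    dist≡δ u v = search-least n 0 (δ-least u v) z≤n (<⇒≤ (δ<n u v))

  dist-isDistance : IsDistance G (dist G)
  dist-isDistance = record
    { d-refl = λ u → trans (dist≡δ u u) (IsDistance.d-refl δ-isDistance u)
    ; d-eq   = λ {u} {v} eq → IsDistance.d-eq δ-isDistance (trans (sym (dist≡δ u v)) eq)
    ; d-step = λ {u} {w} uw v → subst₂ (λ a b → a ≤ suc b) (sym (dist≡δ u v)) (sym (dist≡δ w v)) (IsDistance.d-step δ-isDistance uw v)
    ; d-next = λ {u} {v} eq → map₂ (λ {w} (uw , e) → uw , trans (dist≡δ w v) e)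
                               (IsDistance.d-next δ-isDistance (trans (sym (dist≡δ u v)) eq))
    }

-- The Wiener index along a chain

-- The binomial coefficient m(m - 1)/2, the sum of the numbers below m. Its partial sums `tet` equal
-- (m³ - m)/6, the Wiener index of the path on m vertices.
tri : ℕ → ℕ
tri zero    = 0
tri (suc m) = m + tri m

tet : ℕ → ℕ
tet zero    = 0
tet (suc m) = tri (suc m) + tet m

-- The extreme values are `f u`, `f u + 1`, `f u + 2`, and so on. If `u` is the newest vertex, the
-- induction passes to its older neighbour and raises each of the other `m` values by at most one;
-- otherwise the newest value is at most `f u + m`.
Chain-sum : ∀ {r} → Chain G (r ∷ []) vs → ∀ {f} → Lipschitz G f → ∀ {u} → u ∈ vs →
            ∑ vs f ≤ length vs * f u + tri (length vs)
Chain-sum start {f} lip {u} (here refl) = ≤-reflexive (sym (+-identityʳ (f u + 0)))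
Chain-sum {G = G} (grow {v} {w} {vs} w∈ vw ch) {f} lip {u} u∈ = lemma u∈
  where
  open ≤-Reasoning
  m = length vs
  expand : ∀ m a t → a + (m * suc a + t) ≡ suc m * a + (m + t)
  expand = solve-∀
  expand′ : ∀ m a t → a + m + (m * a + t) ≡ suc m * a + (m + t)
  expand′ = solve-∀
  lemma : u ∈ v ∷ vs → f v + ∑ vs f ≤ suc m * f u + (m + tri m)
  lemma (here refl) = begin
    f u + ∑ vs f                     ≤⟨ +-monoʳ-≤ (f u) (Chain-sum ch lip w∈) ⟩
    f u + (m * f w + tri m)          ≤⟨ +-monoʳ-≤ (f u) (+-monoˡ-≤ (tri m) (*-monoʳ-≤ m (lip (trans (adj-sym G w v) vw)))) ⟩
    f u + (m * suc (f u) + tri m)    ≡⟨ expand m (f u) (tri m) ⟩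
    suc m * f u + (m + tri m)        ∎
  lemma (there u∈) = begin
    f v + ∑ vs f                     ≤⟨ +-mono-≤ (s≤s⁻¹ (≤-trans (Chain-diameter (grow w∈ vw ch) lip (there u∈) (here refl))
                                                              (≤-reflexive (+-suc (f u) m))))
                                                 (Chain-sum ch lip u∈) ⟩
    f u + m + (m * f u + tri m)      ≡⟨ expand′ m (f u) (tri m) ⟩
    suc m * f u + (m + tri m)        ∎

≤-sum-tight : ∀ {a b A B} → a ≤ A → b ≤ B → a + b ≡ A + B → a ≡ A × b ≡ B
≤-sum-tight {a} {b} {A} {B} a≤A b≤B eq with m≤n⇒m<n∨m≡n a≤A
... | inj₁ a<A  = ⊥-elim (<-irrefl eq (+-mono-<-≤ a<A b≤B))
... | inj₂ refl = refl , +-cancelˡ-≡ a b B eq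

rebase : ∀ {a b} → adj G a b ≡ true → Chain G (a ∷ b ∷ []) vs → Chain G (b ∷ []) vs
rebase ab start           = grow (here refl) ab start
rebase ab (grow u∈ vu ch) = grow u∈ vu (rebase ab ch)

module ChainDistance {G : Graph n} {d : Fin n → Fin n → ℕ} (isDistance : IsDistance G d) where
  open Distance isDistance

  d-lipschitz : ∀ u → Lipschitz G (d u)
  d-lipschitz u vw = d-stepʳ u (~-sym vw)

  Chain-row : ∀ {r vs v w} → Chain G (r ∷ []) vs → w ∈ vs → v ~ w → ∑ vs (d v) ≤ tri (suc (length vs))
  Chain-row {vs = vs} {v} {w} ch w∈ vw = begin
    ∑ vs (d v)                               ≤⟨ Chain-sum ch (d-lipschitz v) w∈ ⟩
    length vs * d v w + tri (length vs)      ≡⟨ cong (λ k → length vs * k + tri (length vs)) (d-adj vw) ⟩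
    length vs * 1 + tri (length vs)          ≡⟨ cong (_+ tri (length vs)) (*-identityʳ (length vs)) ⟩
    length vs + tri (length vs)              ∎
    where open ≤-Reasoning

  Chain-pairSum : ∀ {r vs} → Chain G (r ∷ []) vs → pairSum d vs ≤ tet (length vs)
  Chain-pairSum start           = z≤n
  Chain-pairSum (grow w∈ vw ch) = +-mono-≤ (Chain-row ch w∈ vw) (Chain-pairSum ch)

  module _ {a b} (ab : a ~ b) where

    -- Equality in the whole sum is equality in every row. The row of the first vertex added to `a`
    -- and `b` then reads `d w a + d w b ≡ tri 3`, so this vertex is adjacent to exactly one of
    -- them.
    Chain-pairSum-tight : ∀ {vs} → Chain G (a ∷ b ∷ []) vs → pairSum d vs ≡ tet (length vs) →
                          vs ≡ a ∷ b ∷ [] ⊎ (∃[ w ] d w a + d w b ≡ 3)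
    Chain-pairSum-tight start eq = inj₁ refl
    Chain-pairSum-tight (grow {v} w∈ vw ch) eq
      with row , rest ← ≤-sum-tight (Chain-row (rebase ab ch) w∈ vw) (Chain-pairSum (rebase ab ch)) eq
      with Chain-pairSum-tight ch rest
    ... | inj₁ refl = inj₂ (v , trans (cong (d v a +_) (sym (+-identityʳ (d v b)))) row)
    ... | inj₂ far  = inj₂ far

module Levels {G : Graph n} {f : Fin n → ℕ} (lip : Lipschitz G f) {a b : Fin n} (fa : f a ≡ 1) (fb : f b ≡ 1) where

  level< : ∀ {vs u} → Chain G (a ∷ b ∷ []) vs → u ∈ vs → f u < length vs
  level< start (here refl)         rewrite fa = ≤-refl
  level< start (there (here refl)) rewrite fb = ≤-refl
  level< (grow w∈ vw ch) (here refl) = s≤s (≤-trans (lip vw) (level< ch w∈))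
  level< (grow w∈ vw ch) (there u∈)  = m≤n⇒m≤1+n (level< ch u∈)

  -- The extreme levels are 1, 1, 2, 3, up to `length vs` minus one; the repeated 1 accounts for the
  -- `suc`.
  level-sum : ∀ {vs} → Chain G (a ∷ b ∷ []) vs → ∑ vs f ≤ suc (tri (length vs))
  level-sum start rewrite fa | fb = ≤-refl
  level-sum (grow {vs = vs} w∈ vw ch) = ≤-trans (+-mono-≤ (≤-trans (lip vw) (level< ch w∈)) (level-sum ch))
                                          (≤-reflexive (+-suc (length vs) _))

  -- If the sum is attained, each added vertex lies one level beyond all older ones, so only `a` and
  -- `b` can share a level.
  level-injective : ∀ {vs} → Chain G (a ∷ b ∷ []) vs → ∑ vs f ≡ suc (tri (length vs)) →
                    ∀ {s t} → s ∈ vs → t ∈ vs → f s ≡ f t → s ≡ t ⊎ f s ≡ 1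
  level-injective start eq (here refl)         _ _ = inj₂ fa
  level-injective start eq (there (here refl)) _ _ = inj₂ fb
  level-injective (grow {v} {vs = vs} w∈ vw ch) eq {s} {t} = lemma
    where
    tight : f v ≡ length vs × ∑ vs f ≡ suc (tri (length vs))
    tight = ≤-sum-tight (≤-trans (lip vw) (level< ch w∈)) (level-sum ch)
              (trans eq (sym (+-suc (length vs) _)))
    lemma : s ∈ v ∷ vs → t ∈ v ∷ vs → f s ≡ f t → s ≡ t ⊎ f s ≡ 1
    lemma (here refl) (here refl) _ = inj₁ refl
    lemma (here refl) (there t∈) e = ⊥-elim (<-irrefl (trans (sym e) (proj₁ tight)) (level< ch t∈))
    lemma (there s∈) (here refl) e = ⊥-elim (<-irrefl (trans e (proj₁ tight)) (level< ch s∈))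
    lemma (there s∈) (there t∈) e = level-injective ch (proj₂ tight) s∈ t∈ e

-- Recognising B_n^(1) around a diamond

injective⇒↔ : (σ : Fin n → Fin n) → (∀ {u v} → σ u ≡ σ v → u ≡ v) → Fin n ↔ Fin n
injective⇒↔ {n} σ inj = mk↔ₛ′ σ σ⁻¹ σσ⁻¹ (λ u → inj (σσ⁻¹ (σ u)))
  where
  hit : ∀ v → ∃[ u ] u ∈ allFin n × v ≡ σ u
  hit v = ∈-map⁻ σ (Unique-complete (Uniqueₚ.map⁺ inj (Uniqueₚ.allFin⁺ n))
            (≤-reflexive (sym (trans (length-map σ (allFin n)) (length-tabulate {n = n} (λ x → x))))) v)
  σ⁻¹ : Fin n → Fin n
  σ⁻¹ v = proj₁ (hit v)
  σσ⁻¹ : ∀ v → σ (σ⁻¹ v) ≡ v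
  σσ⁻¹ v = sym (proj₂ (proj₂ (hit v)))

-- An induced `K_4^-` that meets the rest of the graph only through `a` and `b`, the ends of its
-- central edge.
record Diamond (G : Graph n) (x y a b : Fin n) : Set where
  field
    x≢y   : x ≢ y
    x≁y   : adj G x y ≢ true
    ab    : adj G a b ≡ true
    xa    : adj G x a ≡ true
    xb    : adj G x b ≡ true
    ya    : adj G y a ≡ true
    yb    : adj G y b ≡ true
    only-x : ∀ {z} → adj G x z ≡ true → z ≡ a ⊎ z ≡ b
    only-y : ∀ {z} → adj G y z ≡ true → z ≡ a ⊎ z ≡ b

Diamond-swap : ∀ {x y a b} → Diamond G x y a b → Diamond G x y b a
Diamond-swap {G = G} {a = a} {b} D = record
  { x≢y = x≢y ; x≁y = x≁y ; ab = trans (adj-sym G b a) ab ; xa = xb ; xb = xa ; ya = yb ; yb = ya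
  ; only-x = λ e → Sum.swap (only-x e) ; only-y = λ e → Sum.swap (only-y e) }
  where open Diamond D

module _ {G : Graph n} {d : Fin n → Fin n → ℕ} (isDistance : IsDistance G d) {x y a b : Fin n} (D : Diamond G x y a b) where
  open Distance isDistance
  open Diamond D

  private
    dxa : d x a ≡ 1
    dxa = d-adj xa
    dxb : d x b ≡ 1
    dxb = d-adj xb

  record Rest (v : Fin n) : Set where
    constructor mkRest
    field
      ≢x : v ≢ x
      ≢y : v ≢ y
      ≢a : v ≢ a
      ≢b : v ≢ b
  open Rest

  rest-level≥2 : ∀ {v} → Rest v → 2 ≤ d x v
  rest-level≥2 rv = d≥2 (λ e → ≢x rv (sym e)) (λ xv → [ ≢a rv , ≢b rv ]′ (only-x xv))

  level-attached : ∀ {v c} → Rest v → d x c ≡ 1 → c ~ v → d x v ≡ 2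
  level-attached {v} rv e cv = ≤-antisym (subst (λ k → d x v ≤ suc k) e (d-stepʳ x cv)) (rest-level≥2 rv)

  module _ (5≤n : 5 ≤ n) (level<n : ∀ {v} → Rest v → 2 + d x v < n)
           (level-inj : ∀ {u v} → Rest u → Rest v → d x u ≡ d x v → u ≡ v)
           {w} (rw : Rest w) (aw : a ~ w) (bw : ¬ b ~ w) where

    -- Class v p: the vertex v plays the role of the vertex p of the graph B_n^(1).
    data Class (v : Fin n) : ℕ → Set where
      isA  : v ≡ a → Class v 0
      isB  : v ≡ b → Class v 1
      isX  : v ≡ x → Class v 2
      isY  : v ≡ y → Class v 3
      rest : ∀ {j} → Rest v → d x v ≡ 2 + j → Class v (4 + j)

    classify : ∀ v → ∃[ p ] Class v p × p < n
    classify v with v F.≟ a | v F.≟ b | v F.≟ x | v F.≟ y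
    ... | yes e | _     | _     | _     = 0 , isA e , ≤-trans (s≤s z≤n) 5≤n
    ... | no _  | yes e | _     | _     = 1 , isB e , ≤-trans (s≤s (s≤s z≤n)) 5≤n
    ... | no _  | no _  | yes e | _     = 2 , isX e , ≤-trans (s≤s (s≤s (s≤s z≤n))) 5≤n
    ... | no _  | no _  | no _  | yes e = 3 , isY e , ≤-trans (s≤s (s≤s (s≤s (s≤s z≤n)))) 5≤n
    ... | no ¬a | no ¬b | no ¬x | no ¬y with d x v in eq | rest-level≥2 (mkRest ¬x ¬y ¬a ¬b)
    ... | suc (suc j) | _ = 4 + j , rest rv eq , subst (λ k → 2 + k < n) eq (level<n rv)
      where
      rv : Rest v
      rv = mkRest ¬x ¬y ¬a ¬b
    ... | suc zero | s≤s ()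
    ... | zero | ()

    Class-injective : ∀ {u v p} → Class u p → Class v p → u ≡ v
    Class-injective (isA refl) (isA refl) = refl
    Class-injective (isB refl) (isB refl) = refl
    Class-injective (isX refl) (isX refl) = refl
    Class-injective (isY refl) (isY refl) = refl
    Class-injective (rest ru eu) (rest rv ev) = level-inj ru rv (trans eu (sym ev))

    private
      only-w : ∀ {v c} → Rest v → d x c ≡ 1 → c ~ v → v ≡ w
      only-w rv e cv = level-inj rv rw (trans (level-attached rv e cv) (sym (level-attached rw dxa aw)))

      -- The vertex before `v` on a geodesic from `x` has the level of `u`. It lies outside the
      -- diamond, so it is `u`, levels being single vertices there.
      consecutive : ∀ {u v i} → Rest u → Rest v → d x u ≡ 2 + i → d x v ≡ 3 + i → u ~ v
      consecutive {u} {v} {i} ru rv eu ev with p , pv , ep ← d-prev ev = subst (_~ v) (level-inj rp ru (trans ep (sym eu))) pv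
        where
        rp : Rest p
        rp = mkRest (λ { refl → 0≢1+n (trans (sym (d-refl x)) ep) })
                    (λ { refl → [ ≢a rv , ≢b rv ]′ (only-y pv) })
                    (λ { refl → 0≢1+n (suc-injective (trans (sym dxa) ep)) })
                    (λ { refl → 0≢1+n (suc-injective (trans (sym dxb) ep)) })

      far : ∀ {u v i j} → d x u ≡ 2 + i → d x v ≡ 2 + j → u ~ v → j ≤ suc i
      far {u} {v} eu ev uv = s≤s⁻¹ (s≤s⁻¹ (subst₂ (λ s t → s ≤ suc t) ev eu (d-stepʳ x uv)))

      adj-rest : ∀ {u v i j} → Rest u → Rest v → d x u ≡ 2 + i → d x v ≡ 2 + j →
                 adj G u v ≡ ⌊ 4 + j ≟ 5 + i ⌋ ∨ ⌊ 4 + i ≟ 5 + j ⌋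
      adj-rest {u} {v} {i} {j} ru rv eu ev with 4 + j ≟ 5 + i | 4 + i ≟ 5 + j
      ... | yes refl | _        = consecutive ru rv eu ev
      ... | no _     | yes refl = ~-sym (consecutive rv ru ev eu)
      ... | no j≢    | no i≢    = ≢true⇒≡false λ uv → case m≤n⇒m<n∨m≡n (far eu ev uv) of λ where
        (inj₂ e) → j≢ (cong (4 +_) e)
        (inj₁ (s≤s j≤i)) → case m≤n⇒m<n∨m≡n (far ev eu (~-sym uv)) of λ where
          (inj₂ e) → i≢ (cong (4 +_) e)
          (inj₁ (s≤s i≤j)) → ~-irrefl (subst (u ~_) (sym (level-inj ru rv
            (trans eu (trans (cong (2 +_) (≤-antisym i≤j j≤i)) (sym ev))))) uv)

      -- Ordering the two positions halves the table of cases; the other half follows by symmetry of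
      -- adjacency.
      adj-≤ : ∀ {u v p q} → p ≤ q → Class u p → Class v q → adj G u v ≡ bE p q ∨ bE q p
      adj-≤ _ (isA refl) (isA refl) = irrefl G a
      adj-≤ _ (isA refl) (isB refl) = ab
      adj-≤ _ (isA refl) (isX refl) = ~-sym xa
      adj-≤ _ (isA refl) (isY refl) = ~-sym ya
      adj-≤ _ (isA refl) (rest {zero} rv ev) =
        subst (a ~_) (level-inj rw rv (trans (level-attached rw dxa aw) (sym ev))) aw
      adj-≤ _ (isA refl) (rest {suc j} rv ev) =
        ≢true⇒≡false λ av → case trans (sym ev) (level-attached rv dxa av) of λ ()
      adj-≤ _ (isB refl) (isB refl) = irrefl G b
      adj-≤ _ (isB refl) (isX refl) = ~-sym xb
      adj-≤ _ (isB refl) (isY refl) = ~-sym yb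
      adj-≤ _ (isB refl) (rest rv ev) = ≢true⇒≡false λ bv → bw (subst (b ~_) (only-w rv dxb bv) bv)
      adj-≤ _ (isX refl) (isX refl) = irrefl G x
      adj-≤ _ (isX refl) (isY refl) = ≢true⇒≡false x≁y
      adj-≤ _ (isX refl) (rest rv ev) = ≢true⇒≡false λ xv → [ ≢a rv , ≢b rv ]′ (only-x xv)
      adj-≤ _ (isY refl) (isY refl) = irrefl G y
      adj-≤ _ (isY refl) (rest rv ev) = ≢true⇒≡false λ yv → [ ≢a rv , ≢b rv ]′ (only-y yv)
      adj-≤ _ (rest ru eu) (rest rv ev) = adj-rest ru rv eu ev
      adj-≤ () (isB _) (isA _)
      adj-≤ () (isX _) (isA _)
      adj-≤ () (isY _) (isA _)
      adj-≤ () (rest _ _) (isA _)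
      adj-≤ (s≤s ()) (isX _) (isB _)
      adj-≤ (s≤s ()) (isY _) (isB _)
      adj-≤ (s≤s ()) (rest _ _) (isB _)
      adj-≤ (s≤s (s≤s ())) (isY _) (isX _)
      adj-≤ (s≤s (s≤s ())) (rest _ _) (isX _)
      adj-≤ (s≤s (s≤s (s≤s ()))) (rest _ _) (isY _)

    adj-Class : ∀ {u v p q} → Class u p → Class v q → adj G u v ≡ bE p q ∨ bE q p
    adj-Class {u} {v} {p} {q} cu cv with ≤-total p q
    ... | inj₁ p≤q = adj-≤ p≤q cu cv
    ... | inj₂ q≤p = trans (adj-sym G u v) (trans (adj-≤ q≤p cv cu) (∨-comm (bE q p) (bE p q)))

    -- The position of a vertex outside the diamond is its distance from `x` plus two: the levels
    -- from 2 on become the path attached at `a`.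
    lollipop : G ≅ Badj n
    lollipop = injective⇒↔ σ σ-inj , λ u v →
        trans (adj-Class (proj₁ (proj₂ (classify u))) (proj₁ (proj₂ (classify v))))
              (cong₂ (λ p q → bE p q ∨ bE q p) (pos u) (pos v))
      where
      σ : Fin n → Fin n
      σ v = fromℕ< (proj₂ (proj₂ (classify v)))
      σ-class : ∀ v → Class v (toℕ (σ v))
      σ-class v = subst (Class v) (sym (Fₚ.toℕ-fromℕ< (proj₂ (proj₂ (classify v))))) (proj₁ (proj₂ (classify v)))
      σ-inj : ∀ {u v} → σ u ≡ σ v → u ≡ v
      σ-inj {u} {v} e = Class-injective (σ-class u) (subst (λ i → Class v (toℕ i)) (sym e) (σ-class v))
      pos : ∀ v → proj₁ (classify v) ≡ toℕ (σ v)
      pos v = sym (Fₚ.toℕ-fromℕ< (proj₂ (proj₂ (classify v))))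

-- Bounds for the Wiener index

tri-closed : ∀ m → 2 * tri m + m ≡ m * m
tri-closed zero    = refl
tri-closed (suc m) = trans (expand m (tri m)) (trans (cong (_+ (m + m + 1)) (tri-closed m)) (square m))
  where
  expand : ∀ m t → 2 * (m + t) + suc m ≡ 2 * t + m + (m + m + 1)
  expand = solve-∀
  square : ∀ m → m * m + (m + m + 1) ≡ suc m * suc m
  square = solve-∀

tet-closed : ∀ m → 6 * tet m + m ≡ m * m * m
tet-closed zero    = refl
tet-closed (suc m) =
  trans (expand m (tri m) (tet m)) (trans (cong₂ (λ s t → s + 3 * t + (3 * m + 1)) (tet-closed m) (tri-closed m)) (cube m))
  where
  expand : ∀ m t T → 6 * (m + t + T) + suc m ≡ 6 * T + m + 3 * (2 * t + m) + (3 * m + 1)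
  expand = solve-∀
  cube : ∀ m → m * m * m + 3 * (m * m) + (3 * m + 1) ≡ suc m * suc m * suc m
  cube = solve-∀

-- The Wiener index of `B_n^(1)` for n = 2 + m. With `x` and `y` the two vertices of degree 2 in the
-- diamond, the summands are the pair `x`, `y`, the rows of `x` and of `y`, and the remaining m
-- vertices, which form a path.
diamondWiener : ℕ → ℕ
diamondWiener m = 2 + suc (tri m) + (suc (tri m) + tet m)

-- The identity is proved with `19 * (2 + m)` added to the right side, since `den` uses truncated
-- subtraction.
den-diamondWiener : ∀ m → den (2 + m) ≡ 6 * diamondWiener m
den-diamondWiener m = trans (cong (_∸ 19 * (2 + m)) cubic) (m+n∸n≡m (6 * diamondWiener m) (19 * (2 + m)))
  where
  expand : ∀ m t T → 6 * (2 + suc t + (suc t + T)) + 19 * (2 + m) ≡ 6 * T + m + 6 * (2 * t + m) + (12 * m + 62)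
  expand = solve-∀
  cube : ∀ m → m * m * m + 6 * (m * m) + (12 * m + 62) ≡ (2 + m) * ((2 + m) * ((2 + m) * 1)) + 54
  cube = solve-∀
  cubic : (2 + m) ^ 3 + 54 ≡ 6 * diamondWiener m + 19 * (2 + m)
  cubic = sym (trans (expand m (tri m) (tet m))
    (trans (cong₂ (λ s t → s + 6 * t + (12 * m + 62)) (tet-closed m) (tri-closed m)) (cube m)))

Complete-length : ∀ {xs : List (Fin n)} → Unique xs → (∀ x → x ∈ xs) → length xs ≡ n
Complete-length {n} {xs} uniq all = ≤-antisym (Unique-length uniq) (begin
  n                            ≡⟨ length-tabulate {n = n} (λ x → x) ⟨
  length (allFin n)            ≡⟨ length≡∑1 (allFin n) ⟩
  ∑ (allFin n) (λ _ → 1)       ≤⟨ ∑-mono-⊆ _ (Uniqueₚ.allFin⁺ n) (λ {x} _ → all x) ⟩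
  ∑ xs (λ _ → 1)               ≡⟨ length≡∑1 xs ⟨
  length xs                    ∎)
  where open ≤-Reasoning

Unique-++-comm : ∀ (xs ys : List (Fin n)) → Unique (xs ++ ys) → Unique (ys ++ xs)
Unique-++-comm xs ys = Permₛₚ.Unique-resp-↭ (setoid _) (↭⇒↭ₛ (Permₚ.++-comm xs ys))

module _ {G : Graph n} (conn : Connected G) {d : Fin n → Fin n → ℕ} (isDistance : IsDistance G d) where
  open Distance isDistance
  open ChainDistance isDistance

  Wiener-bound : 1 ≤ n → Σpairs n d ≤ tet n
  Wiener-bound (s≤s {n = k} _)
    with vs , ch , uniq , all ← Chain-complete {G = G} {base = zero ∷ []} conn (here refl) [] (λ ()) ([] ∷ []) =
    begin
      Σpairs n d              ≡⟨ Σpairs≡pairSum d d-sym d-refl uniq′ all′ ⟩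
      pairSum d vs            ≤⟨ Chain-pairSum ch ⟩
      tet (length vs)         ≡⟨ cong tet (Complete-length uniq′ all′) ⟩
      tet n                   ∎
    where
    open ≤-Reasoning
    uniq′ = Unique-++-comm vs [] uniq
    all′ : ∀ x → x ∈ vs
    all′ x with inj₁ x∈ ← ∈-++⁻ vs (all x) = x∈

  module _ {x y a b} (D : Diamond G x y a b) where
    open Diamond D

    private
      base⁺ : Unique (a ∷ b ∷ x ∷ y ∷ [])
      base⁺ = (ne ab ∷ ne (~-sym xa) ∷ ne (~-sym ya) ∷ []) ∷ (ne (~-sym xb) ∷ ne (~-sym yb) ∷ []) ∷ (x≢y ∷ []) ∷ [] ∷ []
        where
        ne : ∀ {u v} → u ~ v → u ≢ v
        ne uv refl = ~-irrefl uv

      closed : ∀ {u v} → u ∈ x ∷ y ∷ [] → u ~ v → v ∈ a ∷ b ∷ []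
      closed (here refl) xv         with only-x xv
      ... | inj₁ refl = here refl
      ... | inj₂ refl = there (here refl)
      closed (there (here refl)) yv with only-y yv
      ... | inj₁ refl = here refl
      ... | inj₂ refl = there (here refl)

    -- Since `x` and `y` have no neighbours besides `a` and `b`, the other vertices form a chain
    -- from `a` and `b` without them. The pair `x`, `y`, the two rows and the pairs of the chain are
    -- bounded separately, so equality makes all these bounds tight.
    diamond-bound : 5 ≤ n → 6 * Σpairs n d ≤ den n × (6 * Σpairs n d ≡ den n → G ≅ Badj n)
    diamond-bound 5≤n
      with vs , ch , uniq , all ← Chain-complete {G = G} {base = a ∷ b ∷ []} conn (here refl) (x ∷ y ∷ []) closed base⁺ =
        subst (6 * Σpairs n d ≤_) (sym den≡) (*-monoʳ-≤ 6 bound)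
      , λ eq → tight (trans (sym Σ≡) (*-cancelˡ-≡ _ _ 6 (trans eq den≡)))
      where
      m = length vs

      uniq′ : Unique (x ∷ y ∷ vs)
      uniq′ = Unique-++-comm vs (x ∷ y ∷ []) uniq

      all′ : ∀ v → v ∈ x ∷ y ∷ vs
      all′ v = Permₚ.∈-resp-↭ (Permₚ.++-comm vs (x ∷ y ∷ [])) (all v)

      n≡ : 2 + m ≡ n
      n≡ = Complete-length uniq′ all′

      den≡ : den n ≡ 6 * diamondWiener m
      den≡ = trans (cong den (sym n≡)) (den-diamondWiener m)

      dxy : d x y ≡ 2
      dxy = d≡2 x≢y x≁y xa (~-sym ya)

      Σ≡ : Σpairs n d ≡ d x y + ∑ vs (d x) + (∑ vs (d y) + pairSum d vs)
      Σ≡ = Σpairs≡pairSum d d-sym d-refl uniq′ all′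

      x≤ = Levels.level-sum (d-lipschitz x) (d-adj xa) (d-adj xb) ch
      y≤ = Levels.level-sum (d-lipschitz y) (d-adj ya) (d-adj yb) ch
      vs≤ = Chain-pairSum (rebase ab ch)

      bound : Σpairs n d ≤ diamondWiener m
      bound = subst (_≤ diamondWiener m) (sym Σ≡) (+-mono-≤ (+-mono-≤ (≤-reflexive dxy) x≤) (+-mono-≤ y≤ vs≤))

      tight : d x y + ∑ vs (d x) + (∑ vs (d y) + pairSum d vs) ≡ diamondWiener m → G ≅ Badj n
      tight eq = far-end (Chain-pairSum-tight ab ch vs≡)
        where
        split : d x y + ∑ vs (d x) ≡ 2 + suc (tri m) × ∑ vs (d y) + pairSum d vs ≡ suc (tri m) + tet m
        split = ≤-sum-tight (+-mono-≤ (≤-reflexive dxy) x≤) (+-mono-≤ y≤ vs≤) eq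

        vs≡ : pairSum d vs ≡ tet m
        vs≡ = proj₂ (≤-sum-tight y≤ vs≤ (proj₂ split))

        x≡ : ∑ vs (d x) ≡ suc (tri m)
        x≡ = proj₂ (≤-sum-tight (≤-reflexive dxy) x≤ (proj₁ split))

        rest∈ : ∀ {v} → Rest isDistance D v → v ∈ vs
        rest∈ {v} rv with all′ v
        ... | here e          = ⊥-elim (Rest.≢x rv e)
        ... | there (here e)  = ⊥-elim (Rest.≢y rv e)
        ... | there (there v∈) = v∈

        level-inj : ∀ {u v} → Rest isDistance D u → Rest isDistance D v → d x u ≡ d x v → u ≡ v
        level-inj ru rv e with Levels.level-injective (d-lipschitz x) (d-adj xa) (d-adj xb) ch x≡ (rest∈ ru) (rest∈ rv) e
        ... | inj₁ u≡v = u≡v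
        ... | inj₂ e₁ with s≤s () ← subst (2 ≤_) e₁ (rest-level≥2 isDistance D ru)

        level<n : ∀ {v} → Rest isDistance D v → 2 + d x v < n
        level<n {v} rv = subst (2 + d x v <_) n≡ (s≤s (s≤s (Levels.level< (d-lipschitz x) (d-adj xa) (d-adj xb) ch (rest∈ rv))))

        -- The first alternative would leave only four vertices. In the second one `w` is where the
        -- path is attached.
        far-end : vs ≡ a ∷ b ∷ [] ⊎ (∃[ w ] d w a + d w b ≡ 3) → G ≅ Badj n
        far-end (inj₁ refl) = ⊥-elim (<-irrefl n≡ 5≤n)
        far-end (inj₂ (w , e)) = attach (d w a) refl (d w b) refl
          where
          -- The distances to `a` and `b` add up to 2 for `x` and `y` and to 1 for `a` and `b`,
          -- never to 3; hence `w` lies outside the diamond.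
          sum≢3 : ∀ {c i j} → d c a ≡ i → d c b ≡ j → i + j ≢ 3 → w ≢ c
          sum≢3 refl refl ne refl = ne e

          rw : Rest isDistance D w
          rw = mkRest (sum≢3 (d-adj xa) (d-adj xb) λ ()) (sum≢3 (d-adj ya) (d-adj yb) λ ())
                      (sum≢3 (d-refl a) (d-adj ab) λ ()) (sum≢3 (d-adj (~-sym ab)) (d-refl b) λ ())

          unswap : ∀ {v} → Rest isDistance (Diamond-swap D) v → Rest isDistance D v
          unswap (mkRest ≢x ≢y ≢b ≢a) = mkRest ≢x ≢y ≢a ≢b

          distant : ∀ {c i} → d w c ≡ 2 + i → ¬ c ~ w
          distant e cw with () ← trans (sym e) (d-adj (~-sym cw))

          attach : ∀ i → d w a ≡ i → ∀ j → d w b ≡ j → G ≅ Badj n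
          attach 0 ea j eb = ⊥-elim (Rest.≢a rw (d-eq ea))
          attach i ea 0 eb = ⊥-elim (Rest.≢b rw (d-eq eb))
          attach 1 ea (suc (suc j)) eb = lollipop isDistance D 5≤n level<n level-inj rw (~-sym (adj-d ea)) (distant eb)
          attach (suc (suc i)) ea 1 eb =
            lollipop isDistance (Diamond-swap D) 5≤n (λ r → level<n (unswap r)) (λ r s → level-inj (unswap r) (unswap s))
              (mkRest (Rest.≢x rw) (Rest.≢y rw) (Rest.≢b rw) (Rest.≢a rw)) (~-sym (adj-d eb)) (distant ea)
          attach 1 ea 1 eb with () ← trans (sym e) (cong₂ _+_ ea eb)
          attach (suc (suc i)) ea (suc (suc j)) eb
            with s≤s (s≤s (s≤s ())) ← subst (4 ≤_) (trans (cong₂ _+_ (sym ea) (sym eb)) e)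
                                        (+-mono-≤ {2} {2 + i} {2} {2 + j} (s≤s (s≤s z≤n)) (s≤s (s≤s z≤n)))

-- Separating edges and the excess

module _ {n : ℕ} where

  pairs : List (Fin n × Fin n)
  pairs = cartesianProduct (allFin n) (allFin n)

  ΣΣ≡∑pairs : ∀ (f : Fin n → Fin n → ℕ) → ΣΣ f ≡ ∑ pairs (λ (u , v) → f u v)
  ΣΣ≡∑pairs f = sym (∑-cartesianProduct (allFin n) (allFin n) (λ (u , v) → f u v))

  ∑≤ΣΣ : ∀ (f : Fin n → Fin n → ℕ) {L : List (Fin n × Fin n)} → Unique L → ∑ L (λ (u , v) → f u v) ≤ ΣΣ f
  ∑≤ΣΣ f {L} uniq = begin
    ∑ L (λ (u , v) → f u v)
      ≤⟨ ∑-mono-⊆ {xs = pairs} (λ (u , v) → f u v) uniq (λ {(u , v)} _ → ∈-cartesianProduct⁺ (∈-allFin u) (∈-allFin v)) ⟩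
    ∑ pairs (λ (u , v) → f u v)
      ≡⟨ ΣΣ≡∑pairs f ⟨
    ΣΣ f ∎
    where open ≤-Reasoning

  ΣΣ-comm : ∀ (f : (x y u v : Fin n) → ℕ) → ΣΣ (λ x y → ΣΣ (f x y)) ≡ ΣΣ (λ u v → ΣΣ (λ x y → f x y u v))
  ΣΣ-comm f = begin
    ΣΣ (λ x y → ΣΣ (f x y))
      ≡⟨ ΣΣ-cong (λ x y → ΣΣ≡∑pairs (f x y)) ⟩
    ΣΣ (λ x y → ∑ pairs (λ (u , v) → f x y u v))
      ≡⟨ ΣΣ≡∑pairs (λ x y → ∑ pairs (λ (u , v) → f x y u v)) ⟩
    ∑ pairs (λ (x , y) → ∑ pairs (λ (u , v) → f x y u v))
      ≡⟨ ∑-comm pairs pairs (λ (x , y) (u , v) → f x y u v) ⟩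
    ∑ pairs (λ (u , v) → ∑ pairs (λ (x , y) → f x y u v))
      ≡⟨ ΣΣ≡∑pairs (λ u v → ∑ pairs (λ (x , y) → f x y u v)) ⟨
    ΣΣ (λ u v → ∑ pairs (λ (x , y) → f x y u v))
      ≡⟨ ΣΣ-cong (λ u v → ΣΣ≡∑pairs (λ x y → f x y u v)) ⟨
    ΣΣ (λ u v → ΣΣ (λ x y → f x y u v)) ∎
    where open ≡-Reasoning

  -- For one oriented edge the separated ordered pairs form the product of its two sides, which is
  -- the source of the product in the Szeged index.
  ΣΣ-product : ∀ a (p q : Fin n → Bool) →
    ΣΣ (λ x y → [ a ∧ (p x ∧ q y) ]ᵇ) ≡ (if a then Σv n (λ x → [ p x ]ᵇ) * Σv n (λ y → [ q y ]ᵇ) else 0)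
  ΣΣ-product false p q = trans (∑-cong (allFin n) (λ _ → ∑-zero (allFin n))) (∑-zero (allFin n))
  ΣΣ-product true  p q = trans (∑-cong (allFin n) row) (∑-*ʳ (allFin n) (λ x → [ p x ]ᵇ) _)
    where
    row : ∀ x → Σv n (λ y → [ p x ∧ q y ]ᵇ) ≡ [ p x ]ᵇ * Σv n (λ y → [ q y ]ᵇ)
    row x with p x
    ... | true  = sym (+-identityʳ _)
    ... | false = ∑-zero (allFin n)

module Excess {n} {G : Graph n} {d : Fin n → Fin n → ℕ} (isDistance : IsDistance G d) where
  open Distance isDistance

  closer : Fin n → Fin n → ℕ
  closer u v = Σv n (λ w → if d w u <ᵇ d w v then 1 else 0)

  sz : ℕ
  sz = Σpairs n (λ u v → if adj G u v then closer u v * closer v u else 0)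

  wi : ℕ
  wi = Σpairs n d

  -- Oriented: `x` is on the side of `u` and `y` on the side of `v`. At most one orientation of an
  -- edge qualifies, so `μ` counts each separating edge once.
  separates : Fin n → Fin n → Fin n → Fin n → Bool
  separates x y u v = adj G u v ∧ ((d x u <ᵇ d x v) ∧ (d y v <ᵇ d y u))

  Separates : Fin n → Fin n → Fin n × Fin n → Set
  Separates x y (u , v) = separates x y u v ≡ true

  <⇒<ᵇ≡true : ∀ {i j} → i < j → (i <ᵇ j) ≡ true
  <⇒<ᵇ≡true {i} {j} i<j = dec-true (i <? j) i<j

  mkSeparates : ∀ {x y u v} → u ~ v → d x u < d x v → d y v < d y u → Separates x y (u , v)
  mkSeparates uv xu yv = ∧-intro uv (∧-intro (<⇒<ᵇ≡true xu) (<⇒<ᵇ≡true yv))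

  μ : Fin n → Fin n → ℕ
  μ x y = ΣΣ (λ u v → [ separates x y u v ]ᵇ)

  ΣΣμ≡2sz : ΣΣ μ ≡ sz + sz
  ΣΣμ≡2sz = trans (ΣΣ-comm (λ x y u v → [ separates x y u v ]ᵇ))
    (trans (ΣΣ-cong (λ u v → ΣΣ-product (adj G u v) (λ x → d x u <ᵇ d x v) (λ y → d y v <ᵇ d y u)))
           (ΣΣ-double term term-sym term-diag))
    where
    term : Fin n → Fin n → ℕ
    term u v = if adj G u v then closer u v * closer v u else 0
    term-sym : ∀ u v → term u v ≡ term v u
    term-sym u v rewrite adj-sym G v u | *-comm (closer u v) (closer v u) = refl
    term-diag : ∀ u → term u u ≡ 0
    term-diag u rewrite irrefl G u = refl

  μ-sym : ∀ x y → μ x y ≡ μ y x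
  μ-sym x y = trans (∑-comm (allFin n) (allFin n) (λ u v → [ separates x y u v ]ᵇ)) (ΣΣ-cong {n} (λ v u → cong [_]ᵇ (flip v u)))
    where
    flip : ∀ v u → separates x y u v ≡ separates y x v u
    flip v u = cong₂ _∧_ (adj-sym G u v) (∧-comm (d x u <ᵇ d x v) (d y v <ᵇ d y u))

  length≤μ : ∀ {x y L} → Unique L → All (Separates x y) L → length L ≤ μ x y
  length≤μ {x} {y} uniq all = ≤-trans (≤-reflexive (count all)) (∑≤ΣΣ (λ u v → [ separates x y u v ]ᵇ) uniq)
    where
    count : ∀ {L} → All (Separates x y) L → length L ≡ ∑ L (λ (u , v) → [ separates x y u v ]ᵇ)
    count []        = refl
    count (px ∷ ps) = cong₂ _+_ (cong [_]ᵇ (sym px)) (count ps)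

  -- The triangle inequality through `v` bounds `d x v` from below, and the one through `u` bounds
  -- `d u y` from below.
  geodesic-separates : ∀ {x y u v} → u ~ v → d x u + suc (d v y) ≡ d x y → Separates x y (u , v)
  geodesic-separates {x} {y} {u} {v} uv eq = mkSeparates uv
    (+-cancelʳ-≤ (d v y) (suc (d x u)) (d x v)
      (≤-trans (≤-reflexive (trans (sym (+-suc (d x u) (d v y))) eq)) (d-tri x v y)))
    (subst₂ _<_ (d-sym v y) (d-sym u y)
      (+-cancelˡ-≤ (d x u) (suc (d v y)) (d u y) (≤-trans (≤-reflexive eq) (d-tri x u y))))

  -- Edges of a set of geodesics from x towards y, up to distance k from x.
  record Layers (x y : Fin n) (k m : ℕ) : Set where
    field
      edges  : List (Fin n × Fin n)
      unique : Unique edges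
      sep    : All (Separates x y) edges
      below  : All (λ e → d x (proj₁ e) < k) edges
      count  : length edges ≡ m
  open Layers

  noLayers : ∀ {x y} → Layers x y 0 0
  noLayers = record { edges = [] ; unique = [] ; sep = [] ; below = [] ; count = refl }

  addLayer : ∀ {x y k m} → Layers x y k m → ∀ new → Unique new → All (Separates x y) new →
             All (λ e → d x (proj₁ e) ≡ k) new → Layers x y (suc k) (length new + m)
  addLayer ls new uniq seps at = record
    { edges  = new ++ edges ls
    -- New edges start at distance exactly `k` from `x` and the old ones nearer, so no edge repeats.
    ; unique = Uniqueₚ.++⁺ uniq (unique ls) (λ (e∈ , e∈′) → <-irrefl (All.lookup at e∈) (All.lookup (below ls) e∈′))
    ; sep    = Allₚ.++⁺ seps (sep ls)
    ; below  = Allₚ.++⁺ (All.map (λ e → s≤s (≤-reflexive e)) at) (All.map m≤n⇒m≤1+n (below ls))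
    ; count  = trans (length-++ new) (cong (length new +_) (count ls))
    }

  Layers≤μ : ∀ {x y k m} → Layers x y k m → m ≤ μ x y
  Layers≤μ ls = subst (_≤ _) (count ls) (length≤μ (unique ls) (sep ls))

  geodesic-prev : ∀ {x y w k} → d x w ≡ suc k → suc k + d w y ≡ d x y →
                  ∃[ p ] p ~ w × d x p ≡ k × k + d p y ≡ d x y × Separates x y (p , w)
  geodesic-prev {x} {y} {w} {k} eq split with p , pw , ep ← d-prev eq = p , pw , ep , split′ , geodesic-separates pw edge
    where
    edge : d x p + suc (d w y) ≡ d x y
    edge = trans (cong (_+ suc (d w y)) ep) (trans (+-suc k (d w y)) split)
    split′ : k + d p y ≡ d x y
    split′ = ≤-antisym (≤-trans (+-monoʳ-≤ k (d-step pw y)) (≤-reflexive (trans (+-suc k _) split)))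
                       (subst (λ j → d x y ≤ j + d p y) ep (d-tri x p y))

  geodesic : ∀ {x y} k w → d x w ≡ k → k + d w y ≡ d x y → Layers x y k k
  geodesic zero    w eq split = noLayers
  geodesic (suc k) w eq split with p , pw , ep , split′ , sp ← geodesic-prev eq split =
    addLayer (geodesic k p ep split′) ((p , w) ∷ []) ([] ∷ []) (sp ∷ []) (ep ∷ [])

  d≤μ : ∀ x y → d x y ≤ μ x y
  d≤μ x y = Layers≤μ (geodesic (d x y) y refl (trans (cong (d x y +_) (d-refl y)) (+-identityʳ _)))

  excess : Fin n → Fin n → ℕ
  excess x y = μ x y ∸ d x y

  total : ℕ
  total = ΣΣ excess

  2sz≡2wi+total : sz + sz ≡ wi + wi + total
  2sz≡2wi+total = begin
    sz + sz                             ≡⟨ ΣΣμ≡2sz ⟨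
    ΣΣ μ                                ≡⟨ ΣΣ-cong (λ x y → sym (m+[n∸m]≡n (d≤μ x y))) ⟩
    ΣΣ (λ x y → d x y + excess x y)     ≡⟨ ΣΣ-+ d excess ⟩
    ΣΣ d + total                        ≡⟨ cong (_+ total) (ΣΣ-double d d-sym d-refl) ⟩
    wi + wi + total                     ∎
    where open ≡-Reasoning

  excess-sym : ∀ x y → excess x y ≡ excess y x
  excess-sym x y = cong₂ _∸_ (μ-sym x y) (d-sym x y)

  μ⇒excess : ∀ {x y} k {m} → d x y + k ≤ m → m ≤ μ x y → k ≤ excess x y
  μ⇒excess {x} {y} k le le′ = m+n≤o⇒m≤o∸n k (≤-trans (≤-reflexive (+-comm k (d x y))) (≤-trans le le′))

  list⇒excess : ∀ {x y k m} → d x y ≡ m → ∀ L → Unique L → All (Separates x y) L → m + k ≤ length L → k ≤ excess x y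
  list⇒excess {k = k} refl L uniq seps le = μ⇒excess k le (length≤μ uniq seps)

  Different : Fin n × Fin n → Fin n × Fin n → Set
  Different p q = p ≢ q × p ≢ swap q

  -- Each listed pair occurs in `total` together with its reversal, so the list must be free of
  -- repetitions up to swapping.
  excess-total : ∀ {L} → All (λ (x , y) → x ≢ y) L → AllPairs Different L →
                 ∑ L (λ (x , y) → excess x y) + ∑ L (λ (x , y) → excess x y) ≤ total
  excess-total {L} ne diff = begin
    ∑ L e + ∑ L e                  ≡⟨ cong (∑ L e +_) (∑-cong L (λ (x , y) → excess-sym x y)) ⟩
    ∑ L e + ∑ L (e ∘ swap)         ≡⟨ cong (∑ L e +_) (∑-map swap L e) ⟨
    ∑ L e + ∑ (map swap L) e       ≡⟨ ∑-++ L (map swap L) e ⟨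
    ∑ (L ++ map swap L) e          ≤⟨ ∑≤ΣΣ excess (Uniqueₚ.++⁺ uniq (Uniqueₚ.map⁺ (cong swap) uniq) disjoint) ⟩
    total                          ∎
    where
    open ≤-Reasoning
    e : Fin n × Fin n → ℕ
    e (x , y) = excess x y
    uniq : Unique L
    uniq = AllPairs.map proj₁ diff
    clash : ∀ {L} → All (λ (x , y) → x ≢ y) L → AllPairs Different L → ∀ {p} → p ∈ L → swap p ∉ L
    clash (ne ∷ _) _ (here refl) (here eq) = ne (cong proj₂ eq)
    clash (_ ∷ _) (df ∷ _) (here refl) (there q∈) = proj₂ (All.lookup df q∈) refl
    clash (_ ∷ _) (df ∷ _) (there p∈) (here refl) = proj₂ (All.lookup df p∈) refl
    clash (_ ∷ nes) (_ ∷ dfs) (there p∈) (there q∈) = clash nes dfs p∈ q∈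
    disjoint : ∀ {p} → p ∈ L × p ∈ map swap L → ⊥
    disjoint (p∈ , p∈′) with q , q∈ , refl ← ∈-map⁻ swap p∈′ = clash ne diff q∈ p∈

-- Forks, squares and geodetic graphs

module Forks {n} {G : Graph n} {d : Fin n → Fin n → ℕ} (isDistance : IsDistance G d) where
  open Distance isDistance
  open Excess isDistance

  ~⇒≢ : ∀ {u v} → u ~ v → u ≢ v
  ~⇒≢ uv refl = ~-irrefl uv

  d≢⇒≢ : ∀ {x u v i j} → d x u ≡ i → d x v ≡ j → i ≢ j → u ≢ v
  d≢⇒≢ refl refl ne refl = ne refl

  pair-total : ∀ {x y k} → x ≢ y → k ≤ excess x y → k + k ≤ total
  pair-total {x} {y} ne le = ≤-trans (+-mono-≤ le′ le′) (excess-total {L = (x , y) ∷ []} (ne ∷ []) ([] ∷ []))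
    where
    le′ : _ ≤ excess x y + 0
    le′ = ≤-trans le (m≤m+n _ 0)

  two-pair-total : ∀ {x y u v j k} → x ≢ y → u ≢ v → Different (x , y) (u , v) →
                   j ≤ excess x y → k ≤ excess u v → (j + k) + (j + k) ≤ total
  two-pair-total {x} {y} {u} {v} {j} {k} ne ne′ diff le le′ =
    ≤-trans (+-mono-≤ both both) (excess-total {L = (x , y) ∷ (u , v) ∷ []} (ne ∷ ne′ ∷ []) ((diff ∷ []) ∷ [] ∷ []))
    where
    both : j + k ≤ excess x y + (excess u v + 0)
    both = +-mono-≤ le (≤-trans le′ (m≤m+n _ 0))

  -- Each common neighbour is the middle of a geodesic, and its two edges are shared with no other
  -- such geodesic.
  common⇒μ : ∀ {x y cs} → d x y ≡ 2 → Unique cs → All (λ c → x ~ c × c ~ y) cs → length cs + length cs ≤ μ x y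
  common⇒μ {x} {y} {cs} eq uniq all = ≤-trans (≤-reflexive (sym len)) (Layers≤μ second)
    where
    first : Layers x y 1 (length (map (x ,_) cs) + 0)
    first = addLayer noLayers (map (x ,_) cs) (Uniqueₚ.map⁺ (cong proj₂) uniq)
      (Allₚ.map⁺ (All.map (λ (xc , cy) → geodesic-separates xc
        (trans (cong₂ (λ i j → i + suc j) (d-refl x) (d-adj cy)) (sym eq))) all))
      (Allₚ.map⁺ (All.map (λ _ → d-refl x) all))
    second : Layers x y 2 (length (map (_, y) cs) + (length (map (x ,_) cs) + 0))
    second = addLayer first (map (_, y) cs) (Uniqueₚ.map⁺ (cong proj₁) uniq)
      (Allₚ.map⁺ (All.map (λ (xc , cy) → geodesic-separates cy
        (trans (cong₂ (λ i j → i + suc j) (d-adj xc) (d-refl y)) (sym eq))) all))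
      (Allₚ.map⁺ (All.map (λ (xc , _) → d-adj xc) all))
    len : length (map (_, y) cs) + (length (map (x ,_) cs) + 0) ≡ length cs + length cs
    len = cong₂ _+_ (length-map (_, y) cs) (trans (+-identityʳ _) (length-map (x ,_) cs))

  record Square (x y a b : Fin n) : Set where
    constructor square
    field
      x≢y : x ≢ y
      x≁y : ¬ x ~ y
      a≢b : a ≢ b
      xa  : x ~ a
      xb  : x ~ b
      ay  : a ~ y
      by  : b ~ y

  square-excess : ∀ {x y a b} → Square x y a b → 2 ≤ excess x y
  square-excess (square x≢y x≁y a≢b xa xb ay by) =
    μ⇒excess 2 (≤-reflexive (cong (_+ 2) (d≡2 x≢y x≁y xa ay)))
      (common⇒μ (d≡2 x≢y x≁y xa ay) ((a≢b ∷ []) ∷ [] ∷ []) ((xa , ay) ∷ (xb , by) ∷ []))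

  -- Two different geodesics from x to y that differ in their last edge.
  Fork : Fin n → Fin n → Set
  Fork x y = ∃₂ λ p q → p ≢ q × p ~ y × q ~ y × suc (d x p) ≡ d x y × suc (d x q) ≡ d x y

  Fork? : ∀ x y → Dec (Fork x y)
  Fork? x y = Fₚ.any? λ p → Fₚ.any? λ q →
    ¬? (p F.≟ q) ×-dec (p ~? y) ×-dec (q ~? y) ×-dec (suc (d x p) ≟ d x y) ×-dec (suc (d x q) ≟ d x y)

  Square⇒Fork : ∀ {x y a b} → Square x y a b → Fork x y
  Square⇒Fork (square x≢y x≁y a≢b xa xb ay by) = _ , _ , a≢b , ay , by ,
    trans (cong suc (d-adj xa)) (sym (d≡2 x≢y x≁y xa ay)) , trans (cong suc (d-adj xb)) (sym (d≡2 x≢y x≁y xa ay))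

  module _ {x y} (minimal : ∀ x′ y′ → d x′ y′ < d x y → ¬ Fork x′ y′) where

    -- By minimality of the fork its two geodesics meet only in x and y, so they have 2 (d x y) edges.
    disjoint-geodesics : ∀ j {p q} → p ≢ q → d x p ≡ suc j → d x q ≡ suc j →
                         suc j + d p y ≡ d x y → suc j + d q y ≡ d x y → Layers x y (suc j) (suc j * 2)
    disjoint-geodesics j {p} {q} p≢q ep eq splitp splitq
      with p′ , p′p , ep′ , splitp′ , sp ← geodesic-prev ep splitp
         | q′ , q′q , eq′ , splitq′ , sq ← geodesic-prev eq splitq =
      addLayer (lower j refl) ((p′ , p) ∷ (q′ , q) ∷ []) (((λ e → p≢q (cong proj₂ e)) ∷ []) ∷ [] ∷ [])
        (sp ∷ sq ∷ []) (ep′ ∷ eq′ ∷ [])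
      where
      lower : ∀ i → j ≡ i → Layers x y i (i * 2)
      lower zero    _    = noLayers
      lower (suc i) refl with p′ F.≟ q′
      ... | no p′≢q′ = disjoint-geodesics i p′≢q′ ep′ eq′ splitp′ splitq′
      -- If the geodesics met in `p′`, then `p` and `q` would be two last steps from `y` to `p′`: a
      -- fork between closer vertices.
      ... | yes refl = ⊥-elim (minimal y p′ closer-pair
              (p , q , p≢q , ~-sym p′p , ~-sym q′q , next p splitp , next q splitq))
        where
        next : ∀ w → suc (suc i) + d w y ≡ d x y → suc (d y w) ≡ d y p′
        next w split = trans (cong suc (d-sym y w)) (trans (+-cancelˡ-≡ (suc i) _ _
          (trans (+-suc (suc i) (d w y)) (trans split (sym splitp′)))) (d-sym p′ y))
        closer-pair : d y p′ < d x y
        closer-pair = subst₂ _<_ (d-sym p′ y) splitp′ (s≤s (m≤n+m (d p′ y) i))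

    -- For k = `d x y`, the 2k edges of the two geodesics give excess at least k. This is enough for
    -- k ≥ 3, and k = 2 is a square.
    minimal-fork : Fork x y → 6 ≤ total ⊎ (∃₂ λ a b → Square x y a b)
    minimal-fork (p , q , p≢q , py , qy , ep , eq) = lemma (d x y) refl
      where
      lemma : ∀ k → d x y ≡ k → 6 ≤ total ⊎ (∃₂ λ a b → Square x y a b)
      lemma zero e with () ← trans ep e
      lemma (suc zero) e = ⊥-elim (p≢q (trans (sym (d-eq (suc-injective (trans ep e)))) (d-eq (suc-injective (trans eq e)))))
      lemma (suc (suc zero)) e = inj₂ (p , q , square
        (λ { refl → 0≢1+n (trans (sym (d-refl x)) e) }) (λ xy → 0≢1+n (suc-injective (trans (sym (d-adj xy)) e)))
        p≢q (adj-d (suc-injective (trans ep e))) (adj-d (suc-injective (trans eq e))) py qy)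
      lemma (suc (suc (suc i))) e = inj₁ (pair-total {x} {y} (λ { refl → 0≢1+n (trans (sym (d-refl x)) e) })
        (μ⇒excess 3 bound (Layers≤μ paths)))
        where
        ep′ : d x p ≡ 2 + i
        ep′ = suc-injective (trans ep e)
        eq′ : d x q ≡ 2 + i
        eq′ = suc-injective (trans eq e)
        split : ∀ {w} → w ~ y → 2 + i + d w y ≡ d x y
        split wy = trans (cong (2 + i +_) (d-adj wy)) (trans (+-comm (2 + i) 1) (sym e))
        last : ∀ {w} → w ~ y → d x w ≡ 2 + i → Separates x y (w , y)
        last wy ew = geodesic-separates wy (trans (cong₂ (λ s t → s + suc t) ew (d-refl y)) (trans (+-comm (2 + i) 1) (sym e)))
        paths : Layers x y (3 + i) (2 + (2 + i) * 2)
        paths = addLayer (disjoint-geodesics (suc i) p≢q ep′ eq′ (split py) (split qy)) ((p , y) ∷ (q , y) ∷ [])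
          (((λ e′ → p≢q (cong proj₁ e′)) ∷ []) ∷ [] ∷ []) (last py ep′ ∷ last qy eq′ ∷ []) (ep′ ∷ eq′ ∷ [])
        -- With `d x y` equal to 3 + i this compares 6 + i with 6 + 2i.
        bound : d x y + 3 ≤ 2 + (2 + i) * 2
        bound rewrite e = ≤-trans (≤-reflexive (+-comm (3 + i) 3)) (+-monoʳ-≤ 6 (m≤m*n i 2))

  Outcome : Set
  Outcome = 6 ≤ total ⊎ (∃[ x ] ∃[ y ] ∃[ a ] ∃[ b ] Square x y a b)

  fork : ∀ {x y} → Fork x y → Outcome
  fork {x} {y} = <-rec (λ k → ∀ x y → d x y ≡ k → Fork x y → Outcome) descend (d x y) x y refl
    where
    descend : ∀ k → (∀ {j} → j < k → ∀ x y → d x y ≡ j → Fork x y → Outcome) → ∀ x y → d x y ≡ k → Fork x y → Outcome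
    descend k rec x y refl fk with Fₚ.any? (λ x′ → Fₚ.any? (λ y′ → (d x′ y′ <? d x y) ×-dec Fork? x′ y′))
    ... | yes (x′ , y′ , lt , fk′) = rec lt x′ y′ refl fk′
    ... | no ¬smaller with minimal-fork (λ x′ y′ lt fk′ → ¬smaller (x′ , y′ , lt , fk′)) fk
    ... | inj₁ big = inj₁ big
    ... | inj₂ (a , b , sq) = inj₂ (x , y , a , b , sq)

  module Geodetic (geodetic : ∀ {x y} → ¬ Fork x y) (b : Fin n) where

    -- The neighbour of `b` through which a geodesic from `b` to `w` starts. Two of them for the
    -- same `w` would be a fork from `w` to `b`.
    Branch : Fin n → Fin n → Set
    Branch p w = b ~ p × suc (d p w) ≡ d b w

    branch : ∀ {w} → w ≢ b → ∃[ p ] Branch p w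
    branch {w} w≢b with d b w in eq
    ... | zero  = ⊥-elim (w≢b (sym (d-eq eq)))
    ... | suc k with p , bp , e ← d-next eq = p , bp , cong suc e

    branch-unique : ∀ {p q w} → Branch p w → Branch q w → p ≡ q
    branch-unique {p} {q} {w} (bp , ep) (bq , eq) with p F.≟ q
    ... | yes e = e
    ... | no ne = ⊥-elim (geodetic (p , q , ne , ~-sym bp , ~-sym bq ,
      trans (cong suc (d-sym w p)) (trans ep (d-sym b w)) , trans (cong suc (d-sym w q)) (trans eq (d-sym b w))))

    record Conflict : Set where
      constructor conflict
      field
        {w w′ p p′} : Fin n
        ww′  : w ~ w′
        pw   : Branch p w
        p′w′ : Branch p′ w′
        p≢p′ : p ≢ p′
        p≁p′ : ¬ p ~ p′

    -- Along the walk the branch cannot move from the closed neighbourhood of a to c through adjacent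
    -- branches: a branch adjacent to a neighbour of a is again equal or adjacent to a.
    find-conflict : ∀ (E : Fin n → Fin n → Bool) → (∀ {u v} → E u v ≡ true → u ~ v × v ≢ b) →
                    ∀ {a c} → b ~ a → b ~ c → a ≢ c → ¬ a ~ c → Walk E a c → Conflict
    find-conflict E E⇒ {a} {c} ba bc a≢c a≁c walk = go walk (self ba) (inj₁ refl)
      where
      self : ∀ {u} → b ~ u → Branch u u
      self bu = bu , trans (cong suc (d-refl _)) (sym (d-adj bu))
      go : ∀ {w p} → Walk E w c → Branch p w → p ≡ a ⊎ p ~ a → Conflict
      go here pw near with refl ← branch-unique pw (self bc) = [ (λ e → ⊥-elim (a≢c (sym e))) , (λ ca → ⊥-elim (a≁c (~-sym ca))) ]′ near
      go {w} {p} (step {w = w′} ww′ walk) pw near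
        with w~w′ , w′≢b ← E⇒ ww′
        with p′ , p′w′ ← branch w′≢b
        with p F.≟ p′ | p ~? p′
      ... | yes refl | _ = go walk p′w′ near
      ... | no p≢p′ | no p≁p′ = conflict w~w′ pw p′w′ p≢p′ p≁p′
      ... | no p≢p′ | yes pp′ = go walk p′w′ (near′ near)
        where
        near′ : p ≡ a ⊎ p ~ a → p′ ≡ a ⊎ p′ ~ a
        near′ (inj₁ refl) = inj₂ (~-sym pp′)
        near′ (inj₂ pa) with p′ F.≟ a | p′ ~? a
        ... | yes e | _      = inj₁ e
        ... | no _  | yes pa = inj₂ pa
        -- Otherwise `p′` and `a` would be opposite corners of a square with the common neighbours
        -- `b` and `p`.
        ... | no ne | no na  = ⊥-elim (geodetic (Square⇒Fork
                (square ne na (~⇒≢ (proj₁ pw)) (~-sym (proj₁ p′w′)) (~-sym pp′) ba pa)))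

    module _ {w w′ p p′} (ww′ : w ~ w′) (pw : Branch p w) (p′w′ : Branch p′ w′) (p≢p′ : p ≢ p′) where

      -- If `p` were nearer to `w′` than `b` is, it would be a second branch towards `w′`. Used in
      -- both directions, this puts `w` and `w′` at the same distance from `b`.
      foreign-branch : d b w′ ≤ d p w′
      foreign-branch with m≤n⇒m<n∨m≡n (d-step (proj₁ pw) w′)
      ... | inj₁ (s≤s le) = le
      ... | inj₂ e        = ⊥-elim (p≢p′ (branch-unique (proj₁ pw , sym e) p′w′))

      same-level≤ : d b w′ ≤ d b w
      same-level≤ = ≤-trans foreign-branch (≤-trans (d-stepʳ p ww′) (≤-reflexive (proj₂ pw)))

    -- The pairs (p , p′), (r , w′) and (r′ , w) are at distance 2 and are separated by the edges
    -- opposite to them in the odd closed walk b … r w w′ r′ … b, besides those of their geodesics.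
    module _ (cf : Conflict) where
      open Conflict cf

      module _ {k} (bw : d b w ≡ 2 + k) (bw′ : d b w′ ≡ 2 + k) where

        module Side {w w′ p p′} (ww′ : w ~ w′) (pw : Branch p w) (p′w′ : Branch p′ w′) (p≢p′ : p ≢ p′)
                    (bw : d b w ≡ 2 + k) (bw′ : d b w′ ≡ 2 + k) where

          near : d p w ≡ suc k
          near = suc-injective (trans (proj₂ pw) bw)

          far : d p w′ ≡ 2 + k
          far = ≤-antisym (≤-trans (d-stepʳ p ww′) (s≤s (≤-reflexive near)))
                          (≤-trans (≤-reflexive (sym bw′)) (foreign-branch ww′ pw p′w′ p≢p′))

        module S  = Side ww′ pw p′w′ p≢p′ bw bw′
        module S′ = Side (~-sym ww′) p′w′ pw (λ e → p≢p′ (sym e)) bw′ bw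

        apex : 1 ≤ excess p p′
        apex = list⇒excess (d≡2 p≢p′ p≁p′ (~-sym (proj₁ pw)) (proj₁ p′w′)) ((p , b) ∷ (b , p′) ∷ (w , w′) ∷ [])
          (((λ { refl → ~-irrefl (proj₁ pw) }) ∷ (λ { refl → 0≢1+n (trans (sym (d-refl b)) bw′) }) ∷ [])
            ∷ ((λ { refl → 0≢1+n (trans (sym (d-refl b)) bw) }) ∷ []) ∷ [] ∷ [])
          (geodesic-separates (~-sym (proj₁ pw)) (trans (cong₂ (λ i j → i + suc j) (d-refl p) (d-adj (proj₁ p′w′))) (sym dpp′))
            ∷ geodesic-separates (proj₁ p′w′) (trans (cong₂ (λ i j → i + suc j) (d-adj (~-sym (proj₁ pw))) (d-refl p′)) (sym dpp′))
            ∷ mkSeparates ww′ (subst₂ _<_ (sym S.near) (sym S.far) ≤-refl) (subst₂ _<_ (sym S′.near) (sym S′.far) ≤-refl)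
            ∷ [])
          ≤-refl
          where
          dpp′ : d p p′ ≡ 2
          dpp′ = d≡2 p≢p′ p≁p′ (~-sym (proj₁ pw)) (proj₁ p′w′)

        side : ∀ {w w′ p p′} → w ~ w′ → Branch p w → Branch p′ w′ → p ≢ p′ → d b w ≡ 2 + k → d b w′ ≡ 2 + k →
               ∃[ r ] r ≢ w × r ≢ w′ × 1 ≤ excess r w′
        side {w} {w′} {p} {p′} ww′ pw p′w′ p≢p′ bw bw′ with r , rw , pr ← d-prev (Side.near ww′ pw p′w′ p≢p′ bw bw′) =
          r , ~⇒≢ rw , r≢w′ , list⇒excess drw′ ((r , w) ∷ (w , w′) ∷ (b , p′) ∷ [])
            (((λ { refl → ~-irrefl rw }) ∷ (λ { refl → 0≢1+n (trans (sym (d-refl b)) br) }) ∷ [])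
              ∷ ((λ { refl → 0≢1+n (trans (sym (d-refl b)) bw) }) ∷ []) ∷ [] ∷ [])
            (geodesic-separates rw (trans (cong₂ (λ i j → i + suc j) (d-refl r) (d-adj ww′)) (sym drw′))
              ∷ geodesic-separates ww′ (trans (cong₂ (λ i j → i + suc j) (d-adj rw) (d-refl w′)) (sym drw′))
              ∷ mkSeparates (proj₁ p′w′) (subst (_< d r p′) (trans (sym br) (d-sym b r)) rp′)
                  (subst₂ _<_ (trans (sym O.near) (d-sym p′ w′)) (trans (sym bw′) (d-sym b w′)) ≤-refl)
              ∷ [])
            ≤-refl
          where
          module M = Side ww′ pw p′w′ p≢p′ bw bw′
          module O = Side (~-sym ww′) p′w′ pw (λ e → p≢p′ (sym e)) bw′ bw
          br : d b r ≡ suc k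
          br = ≤-antisym (≤-trans (d-step (proj₁ pw) r) (s≤s (≤-reflexive pr)))
                         (s≤s⁻¹ (≤-trans (≤-reflexive (sym bw)) (d-stepʳ b rw)))
          r≢w′ : r ≢ w′
          r≢w′ = d≢⇒≢ br bw′ (λ e → 0≢1+n {0} (+-cancelʳ-≡ (suc k) 0 1 e))
          r≁w′ : ¬ r ~ w′
          r≁w′ rw′ = <-irrefl refl (≤-trans (≤-reflexive (sym M.far)) (≤-trans (d-stepʳ p rw′) (s≤s (≤-reflexive pr))))
          drw′ : d r w′ ≡ 2
          drw′ = d≡2 r≢w′ r≁w′ rw ww′
          -- Otherwise `r` and `w′` would both be last steps on geodesics from `p′` to `w`.
          rp′ : suc k < d r p′
          rp′ = ≰⇒> λ le → geodetic (r , w′ , r≢w′ , rw , ~-sym ww′ ,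
            trans (cong suc (≤-antisym (≤-trans (≤-reflexive (d-sym p′ r)) le)
                                       (s≤s⁻¹ (≤-trans (≤-reflexive (sym O.far)) (d-stepʳ p′ rw)))))
                  (sym O.far) ,
            trans (cong suc O.near) (sym O.far))

        three-pairs : 6 ≤ total
        three-pairs
          with r  , r≢w   , r≢w′  , er  ← side ww′ pw p′w′ p≢p′ bw bw′
             | r′ , r′≢w′ , r′≢w  , er′ ← side (~-sym ww′) p′w′ pw (λ e → p≢p′ (sym e)) bw′ bw =
          ≤-trans (+-mono-≤ three three) (excess-total {L = (p , p′) ∷ (r , w′) ∷ (r′ , w) ∷ []}
            (p≢p′ ∷ r≢w′ ∷ r′≢w ∷ [])
            -- The pair `p`, `p′` differs from the others by distance from `b`: its members are at
            -- distance 1, `w` and `w′` at distance at least 2.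
            ((((λ e → level p′w′ bw′ (cong proj₂ e)) , (λ e → level pw bw′ (cong proj₁ e)))
                ∷ ((λ e → level p′w′ bw (cong proj₂ e)) , (λ e → level pw bw (cong proj₁ e))) ∷ [])
              ∷ (((λ e → ~⇒≢ ww′ (sym (cong proj₂ e))) , (λ e → r≢w (cong proj₁ e))) ∷ []) ∷ [] ∷ []))
          where
          three : 3 ≤ excess p p′ + (excess r w′ + (excess r′ w + 0))
          three = +-mono-≤ apex (+-mono-≤ er (≤-trans er′ (m≤m+n _ 0)))
          level : ∀ {q u v} → Branch q u → d b v ≡ 2 + k → q ≢ v
          level (bq , _) bv = d≢⇒≢ (d-adj bq) bv (λ ())

      conflict-total : 6 ≤ total
      conflict-total = go (d p w) refl
        where
        levels : d b w ≡ d b w′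
        levels = ≤-antisym (same-level≤ (~-sym ww′) p′w′ pw (λ e → p≢p′ (sym e))) (same-level≤ ww′ pw p′w′ p≢p′)
        go : ∀ k → d p w ≡ k → 6 ≤ total
        go (suc k) e = three-pairs bw (trans (sym levels) bw)
          where
          bw : d b w ≡ 2 + k
          bw = trans (sym (proj₂ pw)) (cong suc e)
        -- Here `w` is `p` and `w′` is `p′`, so the edge between them contradicts that the branches
        -- are nonadjacent.
        go zero e = ⊥-elim (p≁p′ (subst₂ _~_ (sym (d-eq e)) (sym (d-eq e′)) ww′))
          where
          e′ : d p′ w′ ≡ 0
          e′ = suc-injective (trans (proj₂ p′w′) (trans (sym levels) (trans (sym (proj₂ pw)) (cong suc e))))

-- Diamonds and blocks

module Squares {n} {G : Graph n} {d : Fin n → Fin n → ℕ} (isDistance : IsDistance G d) where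
  open Distance isDistance
  open Excess isDistance
  open Forks isDistance

  module _ (small : ¬ 6 ≤ total) where

    -- The opposite pair of a square uses up all the excess that is allowed: one more unit at any
    -- other pair gives `6 ≤ total`.
    other-pair : ∀ {x y a b p q} → Square x y a b → p ≢ x → p ≢ y → p ≢ q → ¬ 1 ≤ excess p q
    other-pair sq p≢x p≢y p≢q le = small (two-pair-total (Square.x≢y sq) p≢q
      ((λ e → p≢x (sym (cong proj₁ e))) , (λ e → p≢y (sym (cong proj₂ e)))) (square-excess sq) le)

    other-square : ∀ {x y a b p q s t} → Square x y a b → p ≢ x → p ≢ y → ¬ Square p q s t
    other-square sq p≢x p≢y sq′ = other-pair sq p≢x p≢y (Square.x≢y sq′) (≤-trans (s≤s z≤n) (square-excess sq′))

    -- Otherwise `a` and `b` would be the opposite pair of a second square, on the same four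
    -- vertices.
    square-adjacent : ∀ {x y a b} → Square x y a b → a ~ b
    square-adjacent {a = a} {b} sq@(square x≢y x≁y a≢b xa xb ay by) with a ~? b
    ... | yes ab = ab
    ... | no a≁b = ⊥-elim (other-square sq (λ e → ~⇒≢ xa (sym e)) (~⇒≢ ay)
                     (square a≢b a≁b x≢y (~-sym xa) ay xb (~-sym by)))

    -- A third neighbour `z` of `x` always creates more excess. Adjacency of `z` to `y`, `a` or `b`
    -- gives a third common neighbour or another square. What remains is `d z y` equal to 2, which
    -- closes a pentagon, or to 3, with two geodesics through `x`.
    square-only : ∀ {x y a b z} → Square x y a b → x ~ z → z ≡ a ⊎ z ≡ b
    square-only {x} {y} {a} {b} {z} sq@(square x≢y x≁y a≢b xa xb ay by) xz with z F.≟ a | z F.≟ b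
    ... | yes e | _     = inj₁ e
    ... | no _  | yes e = inj₂ e
    ... | no z≢a | no z≢b = ⊥-elim impossible
      where
      dxy : d x y ≡ 2
      dxy = d≡2 x≢y x≁y xa ay

      third : ∀ {c} → c ≢ a → c ≢ b → x ~ c → c ~ y → ⊥
      third c≢a c≢b xc cy = small (pair-total {k = 3} x≢y (μ⇒excess 3 (≤-trans (≤-reflexive (cong (_+ 3) dxy)) (n≤1+n 5))
        (common⇒μ dxy ((c≢a ∷ c≢b ∷ []) ∷ (a≢b ∷ []) ∷ [] ∷ []) ((xc , cy) ∷ (xa , ay) ∷ (xb , by) ∷ []))))

      z≢x : z ≢ x
      z≢x e = ~⇒≢ xz (sym e)

      z≢y : z ≢ y
      z≢y refl = x≁y xz

      z≁y : ¬ z ~ y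
      z≁y = third z≢a z≢b xz

      -- If `z` is adjacent to both `c` and `c′`, it replaces `x` in the square; if to `c` alone,
      -- then `z` and `c′` have the common neighbours `x` and `c`.
      triangle : ∀ {c c′} → z ≢ c′ → c ≢ c′ → x ~ c → x ~ c′ → c ~ c′ → c ~ y → c′ ~ y → ¬ z ~ c
      triangle {c} {c′} z≢c′ c≢c′ xc xc′ cc′ cy c′y zc with z ~? c′
      ... | yes zc′ = other-square sq z≢x z≢y (square z≢y z≁y c≢c′ zc zc′ cy c′y)
      ... | no z≁c′ = other-square sq z≢x z≢y (square z≢c′ z≁c′ (~⇒≢ xc) (~-sym xz) zc xc′ cc′)

      ab : a ~ b
      ab = square-adjacent sq

      z≁a : ¬ z ~ a
      z≁a = triangle z≢b a≢b xa xb ab ay by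

      z≁b : ¬ z ~ b
      z≁b = triangle z≢a (λ e → a≢b (sym e)) xb xa (~-sym ab) by ay

      dza : d z a ≡ 2
      dza = d≡2 z≢a z≁a (~-sym xz) xa

      pentagon : ∀ {t} → t ~ y → z ~ t → d z y ≡ 2 → ⊥
      pentagon {t} ty zt dzy with x ~? t
      ... | yes xt = third (λ { refl → z≁a zt }) (λ { refl → z≁b zt }) xt ty
      ... | no x≁t with t ~? a
      ... | yes ta = other-square sq (λ { refl → x≁y ty }) (~⇒≢ ty)
                       (square (λ { refl → x≁y ty }) (λ tx → x≁t (~-sym tx)) z≢a (~-sym zt) ta (~-sym xz) (~-sym xa))
      -- The 5-cycle z x a y t has the edge `ty` opposite to `x`, which separates `z` from `a` in
      -- addition to the two edges through `x`.
      ... | no t≁a = other-pair sq z≢x z≢y z≢a (list⇒excess dza ((z , x) ∷ (x , a) ∷ (t , y) ∷ [])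
          (((λ e → z≢x (cong proj₁ e)) ∷ (λ e → x≢y (cong proj₂ e)) ∷ []) ∷ ((λ e → ~⇒≢ ay (cong proj₂ e)) ∷ []) ∷ [] ∷ [])
          (geodesic-separates (~-sym xz) (trans (cong₂ (λ i j → i + suc j) (d-refl z) (d-adj xa)) (sym dza))
            ∷ geodesic-separates xa (trans (cong₂ (λ i j → i + suc j) (d-adj (~-sym xz)) (d-refl a)) (sym dza))
            ∷ mkSeparates ty (subst₂ _<_ (sym (d-adj zt)) (sym dzy) ≤-refl)
                (subst₂ _<_ (sym (d-adj ay)) (sym (d≡2 (λ { refl → z≁a zt }) (λ at → t≁a (~-sym at)) ay (~-sym ty))) ≤-refl)
            ∷ [])
          ≤-refl)

      two-geodesics : d z y ≡ 3 → ⊥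
      -- The second geodesic contributes `xb`, a fourth separating edge for a pair at distance 3.
      two-geodesics dzy = other-pair sq z≢x z≢y z≢y (list⇒excess dzy ((z , x) ∷ (x , a) ∷ (a , y) ∷ (x , b) ∷ [])
        (((λ e → z≢x (cong proj₁ e)) ∷ (λ e → z≢a (cong proj₁ e)) ∷ (λ e → z≢x (cong proj₁ e)) ∷ [])
          ∷ ((λ e → ~⇒≢ xa (cong proj₁ e)) ∷ (λ e → a≢b (cong proj₂ e)) ∷ [])
          ∷ ((λ e → ~⇒≢ xa (sym (cong proj₁ e))) ∷ []) ∷ [] ∷ [])
        (geodesic-separates (~-sym xz) (trans (cong₂ (λ i j → i + suc j) (d-refl z) dxy) (sym dzy))
          ∷ geodesic-separates xa (trans (cong₂ (λ i j → i + suc j) (d-adj (~-sym xz)) (d-adj ay)) (sym dzy))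
          ∷ geodesic-separates ay (trans (cong₂ (λ i j → i + suc j) dza (d-refl y)) (sym dzy))
          ∷ geodesic-separates xb (trans (cong₂ (λ i j → i + suc j) (d-adj (~-sym xz)) (d-adj by)) (sym dzy))
          ∷ [])
        ≤-refl)

      impossible : ⊥
      impossible with m≤n⇒m<n∨m≡n (d≥2 z≢y z≁y)
      ... | inj₁ 3≤ = two-geodesics (≤-antisym (≤-trans (d-step (~-sym xz) y) (s≤s (≤-reflexive dxy))) 3≤)
      ... | inj₂ 2≡ with t , ty , e ← d-prev (sym 2≡) = pentagon ty (adj-d e) (sym 2≡)

    square-diamond : ∀ {x y a b} → Square x y a b → Diamond G x y a b
    square-diamond sq@(square x≢y x≁y a≢b xa xb ay by) = record
      { x≢y = x≢y ; x≁y = x≁y ; ab = square-adjacent sq ; xa = xa ; xb = xb ; ya = ~-sym ay ; yb = ~-sym by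
      ; only-x = square-only sq
      ; only-y = square-only (square (λ e → x≢y (sym e)) (λ yx → x≁y (~-sym yx)) a≢b (~-sym ay) (~-sym by) (~-sym xa) (~-sym xb))
      }

  outcome-diamond : Outcome → 6 ≤ total ⊎ 4 ≤ total × (∃[ x ] ∃[ y ] ∃[ a ] ∃[ b ] Diamond G x y a b)
  outcome-diamond (inj₁ big) = inj₁ big
  outcome-diamond (inj₂ (x , y , a , b , sq)) with 6 ≤? total
  ... | yes big  = inj₁ big
  ... | no small = inj₂ (pair-total (Square.x≢y sq) (square-excess sq) , x , y , a , b , square-diamond small sq)

mapWalk : ∀ {E E′ : Fin n → Fin n → Bool} → (∀ {u v} → E u v ≡ true → E′ u v ≡ true) → ∀ {u v} → Walk E u v → Walk E′ u v
mapWalk E⇒ here          = here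
mapWalk E⇒ (step e walk) = step (E⇒ e) (mapWalk E⇒ walk)

module _ {G : Graph n} {H : Subgraph G} where

  induced : Subgraph G
  induced = record
    { S = S H
    ; E = λ u v → adj G u v ∧ (S H u ∧ S H v)
    ; E⊆G = λ u v e → proj₁ (∧-elim (adj G u v) e)
    ; E⊆S = λ u v e → ∧-elim (S H u) (proj₂ (∧-elim (adj G u v) e))
    ; Esym = λ u v → cong₂ _∧_ (adj-sym G u v) (∧-comm (S H u) (S H v))
    }

  ⊑-induced : ∀ {u v} → E H u v ≡ true → E induced u v ≡ true
  ⊑-induced {u} {v} e = let su , sv = E⊆S H u v e in ∧-intro (E⊆G H u v e) (∧-intro su sv)

  -- Passing to the induced subgraph only adds edges, so it stays connected and without cut
  -- vertices, and maximality applies. Nonadjacency in a block is therefore nonadjacency in `G`.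
  Block-induced : Block G H → ∀ {u v} → S H u ≡ true → S H v ≡ true → adj G u v ≡ true → E H u v ≡ true
  Block-induced (conn , nocut , maximal) su sv uv =
    proj₂ (maximal induced ((λ _ s → s) , (λ u v → ⊑-induced))
      (λ u v su sv → mapWalk ⊑-induced (conn u v su sv))
      (λ w (sw , cut) → nocut w (sw , λ all → cut (λ u v su sv → mapWalk lift (all u v su sv)))))
    _ _ (∧-intro uv (∧-intro su sv))
    where
    lift : ∀ {w u v} → delE H w u v ≡ true → delE induced w u v ≡ true
    lift {w} {u} {v} e = let e₁ , e₂ = ∧-elim (E H u v) e in ∧-intro (⊑-induced e₁) e₂

  not-does-intro : ∀ {P : Set} (P? : Dec P) → ¬ P → not ⌊ P? ⌋ ≡ true
  not-does-intro (yes p) ¬p = ⊥-elim (¬p p)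
  not-does-intro (no _)  _  = refl

  -- Follows the walk to the first edge leaving the closed neighbourhood of `u`: its start `b` has
  -- the nonadjacent neighbours `u` and `c`.
  leave-neighbourhood : ∀ {E : Fin n → Fin n → Bool} → (∀ {p q} → E p q ≡ true → adj G p q ≡ true) →
    ∀ {u v} → u ≢ v → adj G u v ≢ true → Walk E u v →
    ∃₂ λ b c → E b c ≡ true × adj G u b ≡ true × u ≢ c × adj G u c ≢ true
  leave-neighbourhood {E} E⇒ {u} {v} u≢v u≁v walk = go walk (inj₁ refl)
    where
    go : ∀ {p} → Walk E p v → p ≡ u ⊎ adj G u p ≡ true →
         ∃₂ λ b c → E b c ≡ true × adj G u b ≡ true × u ≢ c × adj G u c ≢ true
    go here (inj₁ e)  = ⊥-elim (u≢v (sym e))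
    go here (inj₂ uv) = ⊥-elim (u≁v uv)
    go (step {w = w} pw walk) near with u F.≟ w | adj G u w B.≟ true | near
    ... | yes e  | _      | _         = go walk (inj₁ (sym e))
    ... | no _   | yes uw | _         = go walk (inj₂ uw)
    ... | no _   | no u≁w | inj₁ refl = ⊥-elim (u≁w (E⇒ pw))
    ... | no u≢w | no u≁w | inj₂ up   = _ , w , pw , up , u≢w , u≁w

  module _ {d : Fin n → Fin n → ℕ} (isDistance : IsDistance G d) where
    open Distance isDistance
    open Excess isDistance
    open Forks isDistance

    noncomplete-outcome : Block G H → NonComplete H → Outcome
    noncomplete-outcome block@(conn , nocut , maximal) (u , v , su , sv , u≢v , ¬Euv)
      with Fₚ.any? (λ x → Fₚ.any? (Fork? x))
    ... | yes (x , y , fk) = fork fk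
    ... | no nofork
      with b , c , bc , ub , u≢c , u≁c ← leave-neighbourhood (λ {p} {q} → E⊆G H p q) u≢v
             (λ uv → case trans (sym ¬Euv) (Block-induced block su sv uv) of λ ()) (conn u v su sv) =
      -- Not being a cut vertex provides the walk from `u` to `c` avoiding `b` only under a double
      -- negation, which the decidable goal absorbs.
      inj₁ (decidable-stable (6 ≤? total) λ small →
        nocut b (proj₁ (E⊆S H b c bc) , λ all →
          small (conflict-total b (find-conflict b (delE H b) avoid (~-sym ub) (E⊆G H b c bc) u≢c u≁c
            (all u c (∧-intro su (not-does-intro (u F.≟ b) (~⇒≢ ub)))
                     (∧-intro (proj₂ (E⊆S H b c bc)) (not-does-intro (c F.≟ b) (λ e → ~⇒≢ (E⊆G H b c bc) (sym e)))))))))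
      where
      open Geodetic (λ {x} {y} fk → nofork (x , y , fk))
      avoid : ∀ {b p q} → delE H b p q ≡ true → p ~ q × q ≢ b
      avoid {b} {p} {q} e = let e₁ , e₂ = ∧-elim (E H p q) e in
        E⊆G H p q e₁ , not-does-elim (q F.≟ b) (proj₂ (∧-elim (not ⌊ p F.≟ b ⌋) e₂))

-- The graph B_n^(1)

∑< : ℕ → (ℕ → ℕ) → ℕ
∑< zero    f = 0
∑< (suc n) f = f 0 + ∑< n (f ∘ suc)

∑<-cong : ∀ n {f g : ℕ → ℕ} → (∀ i → f i ≡ g i) → ∑< n f ≡ ∑< n g
∑<-cong zero    eq = refl
∑<-cong (suc n) eq = cong₂ _+_ (eq 0) (∑<-cong n (eq ∘ suc))

∑<-+ : ∀ n (f g : ℕ → ℕ) → ∑< n (λ i → f i + g i) ≡ ∑< n f + ∑< n g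
∑<-+ zero    f g = refl
∑<-+ (suc n) f g = trans (cong (f 0 + g 0 +_) (∑<-+ n (f ∘ suc) (g ∘ suc))) (lemma (f 0) (g 0) _ _)
  where
  lemma : ∀ a b c d → a + b + (c + d) ≡ a + c + (b + d)
  lemma = solve-∀

∑<-0 : ∀ n {f : ℕ → ℕ} → (∀ i → f i ≡ 0) → ∑< n f ≡ 0
∑<-0 zero    eq = refl
∑<-0 (suc n) eq = cong₂ _+_ (eq 0) (∑<-0 n (eq ∘ suc))

∑<-1 : ∀ n {f : ℕ → ℕ} → (∀ i → f i ≡ 1) → ∑< n f ≡ n
∑<-1 zero    eq = refl
∑<-1 (suc n) eq = cong₂ _+_ (eq 0) (∑<-1 n (eq ∘ suc))

∑<-suc : ∀ n (f : ℕ → ℕ) → ∑< n (suc ∘ f) ≡ n + ∑< n f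
∑<-suc n f = trans (∑<-+ n (λ _ → 1) f) (cong (_+ ∑< n f) (∑<-1 n (λ _ → refl)))

∑<-id : ∀ n → ∑< n (λ i → i) ≡ tri n
∑<-id zero    = refl
∑<-id (suc n) = trans (∑<-suc n (λ i → i)) (cong (n +_) (∑<-id n))

Σv-toℕ : ∀ n (f : ℕ → ℕ) → Σv n (f ∘ toℕ) ≡ ∑< n f
Σv-toℕ zero    f = refl
Σv-toℕ (suc n) f = cong (f 0 +_) (trans (cong sum step-map) (Σv-toℕ n (f ∘ suc)))
  where
  step-map : map (f ∘ toℕ) (tabulate suc) ≡ map (f ∘ suc ∘ toℕ) (allFin n)
  step-map = trans (map-tabulate suc (f ∘ toℕ)) (sym (map-tabulate (λ i → i) (f ∘ suc ∘ toℕ)))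

∑pairs< : ℕ → (ℕ → ℕ → ℕ) → ℕ
∑pairs< n f = ∑< n (λ p → ∑< n (λ q → if p <ᵇ q then f p q else 0))

<ᵇ-suc : ∀ i → (i <ᵇ suc i) ≡ true
<ᵇ-suc zero    = refl
<ᵇ-suc (suc i) = <ᵇ-suc i

suc-<ᵇ : ∀ i → (suc i <ᵇ i) ≡ false
suc-<ᵇ zero    = refl
suc-<ᵇ (suc i) = suc-<ᵇ i

<ᵇ-irrefl : ∀ i → (i <ᵇ i) ≡ false
<ᵇ-irrefl zero    = refl
<ᵇ-irrefl (suc i) = <ᵇ-irrefl i

distB : ℕ → ℕ → ℕ
distB 0 0 = 0
distB 0 1 = 1
distB 0 2 = 1
distB 0 3 = 1
distB 1 0 = 1
distB 1 1 = 0
distB 1 2 = 1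
distB 1 3 = 1
distB 2 0 = 1
distB 2 1 = 1
distB 2 2 = 0
distB 2 3 = 2
distB 3 0 = 1
distB 3 1 = 1
distB 3 2 = 2
distB 3 3 = 0
distB 0 (suc (suc (suc (suc j)))) = 1 + j
distB 1 (suc (suc (suc (suc j)))) = 2 + j
distB 2 (suc (suc (suc (suc j)))) = 2 + j
distB 3 (suc (suc (suc (suc j)))) = 2 + j
distB (suc (suc (suc (suc i)))) 0 = 1 + i
distB (suc (suc (suc (suc i)))) 1 = 2 + i
distB (suc (suc (suc (suc i)))) 2 = 2 + i
distB (suc (suc (suc (suc i)))) 3 = 2 + i
distB (suc (suc (suc (suc i)))) (suc (suc (suc (suc j)))) = ∣ i - j ∣

adjB : ℕ → ℕ → Bool
adjB p q = bE p q ∨ bE q p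

data BEdge : ℕ → ℕ → Set where
  e01  : BEdge 0 1
  e02  : BEdge 0 2
  e03  : BEdge 0 3
  e04  : BEdge 0 4
  e12  : BEdge 1 2
  e13  : BEdge 1 3
  path : ∀ i → BEdge (4 + i) (5 + i)

bE⇒BEdge : ∀ p q → bE p q ≡ true → BEdge p q
bE⇒BEdge 0 1 _ = e01
bE⇒BEdge 0 2 _ = e02
bE⇒BEdge 0 3 _ = e03
bE⇒BEdge 0 4 _ = e04
bE⇒BEdge 1 2 _ = e12
bE⇒BEdge 1 3 _ = e13
bE⇒BEdge (suc (suc (suc (suc i)))) q eq with refl ← does-elim (q ≟ 5 + i) eq = path i

BEdge⇒bE : ∀ {p q} → BEdge p q → bE p q ≡ true
BEdge⇒bE e01 = refl
BEdge⇒bE e02 = refl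
BEdge⇒bE e03 = refl
BEdge⇒bE e04 = refl
BEdge⇒bE e12 = refl
BEdge⇒bE e13 = refl
BEdge⇒bE (path i) = does-intro (5 + i ≟ 5 + i) refl

-- Symmetric, so one table over the edges in a fixed orientation serves both orientations.
data Near : ℕ → ℕ → Set where
  same : ∀ {k} → Near k k
  up   : ∀ {k} → Near k (suc k)
  down : ∀ {k} → Near (suc k) k

Near⇒≤ : ∀ {i j} → Near i j → i ≤ suc j
Near⇒≤ same = n≤1+n _
Near⇒≤ up   = m≤n⇒m≤1+n (n≤1+n _)
Near⇒≤ down = ≤-refl

Near-sym : ∀ {i j} → Near i j → Near j i
Near-sym same = same
Near-sym up   = down
Near-sym down = up

∣-∣-near : ∀ i j → Near ∣ i - j ∣ ∣ suc i - j ∣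
∣-∣-near zero    zero    = up
∣-∣-near zero    (suc j) = down
∣-∣-near (suc i) zero    = up
∣-∣-near (suc i) (suc j) = ∣-∣-near i j

BEdge-near : ∀ {p r} → BEdge p r → ∀ q → Near (distB p q) (distB r q)
BEdge-near e01 0 = up
BEdge-near e01 1 = down
BEdge-near e01 2 = same
BEdge-near e01 3 = same
BEdge-near e01 (suc (suc (suc (suc j)))) = up
BEdge-near e02 0 = up
BEdge-near e02 1 = same
BEdge-near e02 2 = down
BEdge-near e02 3 = up
BEdge-near e02 (suc (suc (suc (suc j)))) = up
BEdge-near e03 0 = up
BEdge-near e03 1 = same
BEdge-near e03 2 = up
BEdge-near e03 3 = down
BEdge-near e03 (suc (suc (suc (suc j)))) = up
BEdge-near e04 0 = up
BEdge-near e04 1 = up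
BEdge-near e04 2 = up
BEdge-near e04 3 = up
BEdge-near e04 (suc (suc (suc (suc j)))) = down
BEdge-near e12 0 = same
BEdge-near e12 1 = up
BEdge-near e12 2 = down
BEdge-near e12 3 = up
BEdge-near e12 (suc (suc (suc (suc j)))) = same
BEdge-near e13 0 = same
BEdge-near e13 1 = up
BEdge-near e13 2 = up
BEdge-near e13 3 = down
BEdge-near e13 (suc (suc (suc (suc j)))) = same
BEdge-near (path i) 0 = up
BEdge-near (path i) 1 = up
BEdge-near (path i) 2 = up
BEdge-near (path i) 3 = up
BEdge-near (path i) (suc (suc (suc (suc j)))) = ∣-∣-near i j

adjB-step : ∀ {p r} q → adjB p r ≡ true → distB p q ≤ suc (distB r q)
adjB-step {p} {r} q eq with ∨-elim (bE p r) eq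
... | inj₁ e = Near⇒≤ (BEdge-near (bE⇒BEdge p r e) q)
... | inj₂ e = Near⇒≤ (Near-sym (BEdge-near (bE⇒BEdge r p e) q))

distB-refl : ∀ p → distB p p ≡ 0
distB-refl 0 = refl
distB-refl 1 = refl
distB-refl 2 = refl
distB-refl 3 = refl
distB-refl (suc (suc (suc (suc i)))) = ∣n-n∣≡0 i

distB-eq : ∀ p q → distB p q ≡ 0 → p ≡ q
distB-eq 0 0 _ = refl
distB-eq 1 1 _ = refl
distB-eq 2 2 _ = refl
distB-eq 3 3 _ = refl
distB-eq (suc (suc (suc (suc i)))) (suc (suc (suc (suc j)))) eq = cong (4 +_) (∣m-n∣≡0⇒m≡n eq)
distB-eq 0 1 ()
distB-eq 0 2 ()
distB-eq 0 3 ()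
distB-eq 1 0 ()
distB-eq 1 2 ()
distB-eq 1 3 ()
distB-eq 2 0 ()
distB-eq 2 1 ()
distB-eq 2 3 ()
distB-eq 3 0 ()
distB-eq 3 1 ()
distB-eq 3 2 ()
distB-eq 0 (suc (suc (suc (suc j)))) ()
distB-eq 1 (suc (suc (suc (suc j)))) ()
distB-eq 2 (suc (suc (suc (suc j)))) ()
distB-eq 3 (suc (suc (suc (suc j)))) ()
distB-eq (suc (suc (suc (suc i)))) 0 ()
distB-eq (suc (suc (suc (suc i)))) 1 ()
distB-eq (suc (suc (suc (suc i)))) 2 ()
distB-eq (suc (suc (suc (suc i)))) 3 ()

distB-sym : ∀ p q → distB p q ≡ distB q p
distB-sym 0 0 = refl
distB-sym 0 1 = refl
distB-sym 0 2 = refl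
distB-sym 0 3 = refl
distB-sym 1 0 = refl
distB-sym 1 1 = refl
distB-sym 1 2 = refl
distB-sym 1 3 = refl
distB-sym 2 0 = refl
distB-sym 2 1 = refl
distB-sym 2 2 = refl
distB-sym 2 3 = refl
distB-sym 3 0 = refl
distB-sym 3 1 = refl
distB-sym 3 2 = refl
distB-sym 3 3 = refl
distB-sym 0 (suc (suc (suc (suc j)))) = refl
distB-sym 1 (suc (suc (suc (suc j)))) = refl
distB-sym 2 (suc (suc (suc (suc j)))) = refl
distB-sym 3 (suc (suc (suc (suc j)))) = refl
distB-sym (suc (suc (suc (suc i)))) 0 = refl
distB-sym (suc (suc (suc (suc i)))) 1 = refl
distB-sym (suc (suc (suc (suc i)))) 2 = refl
distB-sym (suc (suc (suc (suc i)))) 3 = refl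
distB-sym (suc (suc (suc (suc i)))) (suc (suc (suc (suc j)))) = ∣-∣-comm i j

∣-∣-next : ∀ i j {k} → ∣ i - j ∣ ≡ suc k → (i < j × ∣ suc i - j ∣ ≡ k) ⊎ (∃[ i′ ] i ≡ suc i′ × ∣ i′ - j ∣ ≡ k)
∣-∣-next zero    (suc j) refl = inj₁ (s≤s z≤n , refl)
∣-∣-next (suc i) zero    refl = inj₂ (i , refl , ∣-∣-identityʳ i)
∣-∣-next (suc i) (suc j) eq with ∣-∣-next i j eq
... | inj₁ (lt , e)        = inj₁ (s≤s lt , e)
... | inj₂ (i′ , refl , e) = inj₂ (suc i′ , refl , e)

adjB-sym : ∀ {p q} → adjB p q ≡ true → adjB q p ≡ true
adjB-sym {p} {q} eq = trans (∨-comm (bE q p) (bE p q)) eq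

BEdge⇒adjB : ∀ {p q} → BEdge p q → adjB p q ≡ true
BEdge⇒adjB {p} {q} e = cong (_∨ bE q p) (BEdge⇒bE e)

BEdge⇒adjBʳ : ∀ {p q} → BEdge q p → adjB p q ≡ true
BEdge⇒adjBʳ {p} {q} e = adjB-sym {q} {p} (BEdge⇒adjB e)

module _ {n} (5≤n : 5 ≤ n) where

  private
    head : ∀ {k} → k ≤ 4 → k < n
    head k≤4 = ≤-trans (s≤s k≤4) 5≤n

    0<n : 0 < n
    0<n = head z≤n

  distB-next : ∀ p q {k} → p < n → q < n → distB p q ≡ suc k → ∃[ r ] r < n × adjB p r ≡ true × distB r q ≡ k
  distB-next 0 1 _ q<n refl = 1 , q<n , refl , refl
  distB-next 0 2 _ q<n refl = 2 , q<n , refl , refl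
  distB-next 0 3 _ q<n refl = 3 , q<n , refl , refl
  distB-next 1 0 _ q<n refl = 0 , q<n , refl , refl
  distB-next 1 2 _ q<n refl = 2 , q<n , refl , refl
  distB-next 1 3 _ q<n refl = 3 , q<n , refl , refl
  distB-next 2 0 _ q<n refl = 0 , q<n , refl , refl
  distB-next 2 1 _ q<n refl = 1 , q<n , refl , refl
  distB-next 2 3 _ q<n refl = 0 , 0<n , refl , refl
  distB-next 3 0 _ q<n refl = 0 , q<n , refl , refl
  distB-next 3 1 _ q<n refl = 1 , q<n , refl , refl
  distB-next 3 2 _ q<n refl = 0 , 0<n , refl , refl
  distB-next 0 (suc (suc (suc (suc j)))) _ _ refl = 4 , head ≤-refl , refl , refl
  distB-next 1 (suc (suc (suc (suc j)))) _ _ refl = 0 , 0<n , refl , refl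
  distB-next 2 (suc (suc (suc (suc j)))) _ _ refl = 0 , 0<n , refl , refl
  distB-next 3 (suc (suc (suc (suc j)))) _ _ refl = 0 , 0<n , refl , refl
  distB-next 4 0 _ _ refl = 0 , 0<n , refl , refl
  distB-next 4 1 _ _ refl = 0 , 0<n , refl , refl
  distB-next 4 2 _ _ refl = 0 , 0<n , refl , refl
  distB-next 4 3 _ _ refl = 0 , 0<n , refl , refl
  distB-next (suc (suc (suc (suc (suc i))))) 0 p<n _ refl = 4 + i , <-trans ≤-refl p<n , BEdge⇒adjBʳ (path i) , refl
  distB-next (suc (suc (suc (suc (suc i))))) 1 p<n _ refl = 4 + i , <-trans ≤-refl p<n , BEdge⇒adjBʳ (path i) , refl
  distB-next (suc (suc (suc (suc (suc i))))) 2 p<n _ refl = 4 + i , <-trans ≤-refl p<n , BEdge⇒adjBʳ (path i) , refl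
  distB-next (suc (suc (suc (suc (suc i))))) 3 p<n _ refl = 4 + i , <-trans ≤-refl p<n , BEdge⇒adjBʳ (path i) , refl
  distB-next (suc (suc (suc (suc i)))) (suc (suc (suc (suc j)))) p<n q<n eq with ∣-∣-next i j eq
  -- Moving outwards stays below `n` because the step does not pass `q`.
  ... | inj₁ (i<j , e)       = 5 + i , ≤-trans (s≤s (+-monoʳ-≤ 4 i<j)) q<n , BEdge⇒adjB (path i) , e
  ... | inj₂ (i′ , refl , e) = 4 + i′ , <-trans ≤-refl p<n , BEdge⇒adjBʳ (path i′) , e

closerB : ℕ → ℕ → ℕ → ℕ
closerB n p q = ∑< n (λ w → if distB w p <ᵇ distB w q then 1 else 0)

termB : ℕ → ℕ → ℕ → ℕ
termB n p q = if adjB p q then closerB n p q * closerB n q p else 0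

module _ {n} (5≤n : 5 ≤ n) {G : Graph n} (iso : G ≅ Badj n) where

  private
    σ : Fin n → Fin n
    σ = Inverse.to (proj₁ iso)

    ι : Fin n → ℕ
    ι u = toℕ (σ u)

    ι-injective : ∀ {u v} → ι u ≡ ι v → u ≡ v
    ι-injective {u} {v} e = trans (sym (Inverse.strictlyInverseʳ (proj₁ iso) u))
      (trans (cong (Inverse.from (proj₁ iso)) (Fₚ.toℕ-injective e)) (Inverse.strictlyInverseʳ (proj₁ iso) v))

    ι-surjective : ∀ {r} → r < n → ∃[ w ] ι w ≡ r
    ι-surjective r<n = Inverse.from (proj₁ iso) (fromℕ< r<n) ,
      trans (cong toℕ (Inverse.strictlyInverseˡ (proj₁ iso) (fromℕ< r<n))) (Fₚ.toℕ-fromℕ< r<n)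

    adj≡ : ∀ u v → adj G u v ≡ adjB (ι u) (ι v)
    adj≡ = proj₂ iso

  -- By uniqueness of the distance, this computes all distances in any copy of `B_n^(1)`.
  distB-isDistance : IsDistance G (λ u v → distB (ι u) (ι v))
  distB-isDistance = record
    { d-refl = λ u → distB-refl (ι u)
    ; d-eq   = λ {u} {v} e → ι-injective (distB-eq (ι u) (ι v) e)
    ; d-step = λ {u} {w} uw v → adjB-step {ι u} {ι w} (ι v) (trans (sym (adj≡ u w)) uw)
    ; d-next = next
    }
    where
    next : ∀ {u v k} → distB (ι u) (ι v) ≡ suc k → ∃[ w ] adj G u w ≡ true × distB (ι w) (ι v) ≡ k
    next {u} {v} e with r , r<n , ur , e′ ← distB-next 5≤n (ι u) (ι v) (Fₚ.toℕ<n (σ u)) (Fₚ.toℕ<n (σ v)) e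
      with w , refl ← ι-surjective r<n = w , trans (adj≡ u w) ur , e′

  Σv-ι : ∀ (f : ℕ → ℕ) → Σv n (f ∘ ι) ≡ ∑< n f
  Σv-ι f = trans (Σv-injective σ (λ e → ι-injective (cong toℕ e)) (f ∘ toℕ)) (Σv-toℕ n f)

  -- The isomorphism need not preserve the order of the vertices, so the re-indexing goes through
  -- sums over ordered pairs.
  Σpairs-ι : ∀ (f : ℕ → ℕ → ℕ) → (∀ p q → f p q ≡ f q p) → (∀ p → f p p ≡ 0) →
             Σpairs n (λ u v → f (ι u) (ι v)) ≡ ∑pairs< n f
  Σpairs-ι f fsym fdiag = trans (double-injective (begin
    Σpairs n fι + Σpairs n fι            ≡⟨ ΣΣ-double fι (λ u v → fsym (ι u) (ι v)) (λ u → fdiag (ι u)) ⟨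
    ΣΣ fι                                ≡⟨ ∑-cong (allFin n) (λ u → Σv-ι (f (ι u))) ⟩
    Σv n (λ u → ∑< n (f (ι u)))          ≡⟨ Σv-ι (λ p → ∑< n (f p)) ⟩
    ∑< n (λ p → ∑< n (f p))              ≡⟨ Σv-toℕ n (λ p → ∑< n (f p)) ⟨
    Σv n (λ u → ∑< n (f (toℕ u)))        ≡⟨ ∑-cong (allFin n) (λ u → sym (Σv-toℕ n (f (toℕ u)))) ⟩
    ΣΣ ft                                ≡⟨ ΣΣ-double ft (λ u v → fsym (toℕ u) (toℕ v)) (λ u → fdiag (toℕ u)) ⟩
    Σpairs n ft + Σpairs n ft            ∎))
    (trans (∑-cong (allFin n) (λ u → Σv-toℕ n (λ q → if toℕ u <ᵇ q then f (toℕ u) q else 0)))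
           (Σv-toℕ n (λ p → ∑< n (λ q → if p <ᵇ q then f p q else 0))))
    where
    open ≡-Reasoning
    fι ft : Fin n → Fin n → ℕ
    fι u v = f (ι u) (ι v)
    ft u v = f (toℕ u) (toℕ v)

  termB-sym : ∀ p q → termB n p q ≡ termB n q p
  termB-sym p q rewrite ∨-comm (bE p q) (bE q p) | *-comm (closerB n p q) (closerB n q p) = refl

  adjB-irrefl : ∀ p → adjB p p ≡ false
  adjB-irrefl p = ≢true⇒≡false λ e → no-loop p (bE⇒BEdge p p ([ (λ x → x) , (λ x → x) ]′ (∨-elim (bE p p) e)))
    where
    no-loop : ∀ p → ¬ BEdge p p
    no-loop p ()

  termB-diag : ∀ p → termB n p p ≡ 0
  termB-diag p rewrite adjB-irrefl p = refl

  module _ {d : Fin n → Fin n → ℕ} (isDistance : IsDistance G d) where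
    open Excess isDistance

    private
      d≡distB : ∀ u v → d u v ≡ distB (ι u) (ι v)
      d≡distB = IsDistance-unique isDistance distB-isDistance

    wi≡ : wi ≡ ∑pairs< n distB
    wi≡ = trans (Σpairs-cong d≡distB) (Σpairs-ι distB distB-sym distB-refl)

    sz≡ : sz ≡ ∑pairs< n (termB n)
    sz≡ = trans (Σpairs-cong term≡) (Σpairs-ι (termB n) termB-sym termB-diag)
      where
      closer≡ : ∀ u v → closer u v ≡ closerB n (ι u) (ι v)
      closer≡ u v = trans (∑-cong (allFin n) (λ w → cong₂ (λ i j → if i <ᵇ j then 1 else 0) (d≡distB w u) (d≡distB w v)))
                          (Σv-ι (λ w → if distB w (ι u) <ᵇ distB w (ι v) then 1 else 0))
      term≡ : ∀ u v → (if adj G u v then closer u v * closer v u else 0) ≡ termB n (ι u) (ι v)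
      term≡ u v = cong₃ (adj≡ u v) (cong₂ _*_ (closer≡ u v) (closer≡ v u))
        where
        cong₃ : ∀ {b b′ : Bool} {i j} → b ≡ b′ → i ≡ j → (if b then i else 0) ≡ (if b′ then j else 0)
        cong₃ refl refl = refl

-- The ratio

module _ (k : ℕ) where

  private
    tail-up : ∑< k (λ w → if w <ᵇ suc w then 1 else 0) ≡ k
    tail-up = ∑<-1 k (λ w → cong [_]ᵇ (<ᵇ-suc w))

    tail-down : ∑< k (λ w → if suc w <ᵇ w then 1 else 0) ≡ 0
    tail-down = ∑<-0 k (λ w → cong [_]ᵇ (suc-<ᵇ w))

    tail-equal : ∑< k (λ w → if w <ᵇ w then 1 else 0) ≡ 0
    tail-equal = ∑<-0 k (λ w → cong [_]ᵇ (<ᵇ-irrefl w))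

  -- The terms of the vertices 0 to 3 compute; the `k` path vertices are nearer to 0 than to 1, 2 or
  -- 3, and equidistant from these three.
  closer-01 : closerB (4 + k) 0 1 ≡ 1 + k
  closer-01 = cong suc tail-up

  closer-10 : closerB (4 + k) 1 0 ≡ 1
  closer-10 = cong suc tail-down

  closer-02 : closerB (4 + k) 0 2 ≡ 2 + k
  closer-02 = cong (2 +_) tail-up

  closer-20 : closerB (4 + k) 2 0 ≡ 1
  closer-20 = cong suc tail-down

  closer-03 : closerB (4 + k) 0 3 ≡ 2 + k
  closer-03 = cong (2 +_) tail-up

  closer-30 : closerB (4 + k) 3 0 ≡ 1
  closer-30 = cong suc tail-down

  closer-12 : closerB (4 + k) 1 2 ≡ 2
  closer-12 = cong (2 +_) tail-equal

  closer-21 : closerB (4 + k) 2 1 ≡ 1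
  closer-21 = cong suc tail-equal

  closer-13 : closerB (4 + k) 1 3 ≡ 2
  closer-13 = cong (2 +_) tail-equal

  closer-31 : closerB (4 + k) 3 1 ≡ 1
  closer-31 = cong suc tail-equal

  closer-04 : closerB (4 + k) 0 4 ≡ 4
  closer-04 = cong (4 +_) (trans (∑<-cong k (λ w → cong (λ i → [ suc w <ᵇ i ]ᵇ) (∣-∣-identityʳ w))) tail-down)

  closer-40 : closerB (4 + k) 4 0 ≡ k
  closer-40 = trans (∑<-cong k (λ w → cong (λ i → [ i <ᵇ suc w ]ᵇ) (∣-∣-identityʳ w))) tail-up

path-closerˡ : ∀ k i → i < k → ∑< k (λ w → if ∣ w - i ∣ <ᵇ ∣ w - suc i ∣ then 1 else 0) ≡ suc i
path-closerˡ (suc k) zero    _         = cong suc (∑<-0 k (λ w →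
  trans (cong (λ j → [ suc w <ᵇ j ]ᵇ) (∣-∣-identityʳ w)) (cong [_]ᵇ (suc-<ᵇ w))))
path-closerˡ (suc k) (suc i) (s≤s i<k) = cong₂ _+_ (cong [_]ᵇ (<ᵇ-suc i)) (path-closerˡ k i i<k)

path-closerʳ : ∀ k i → ∑< k (λ w → if ∣ w - suc i ∣ <ᵇ ∣ w - i ∣ then 1 else 0) ≡ k ∸ suc i
path-closerʳ zero    i       = refl
path-closerʳ (suc k) zero    = ∑<-1 k (λ w →
  trans (cong (λ j → [ j <ᵇ suc w ]ᵇ) (∣-∣-identityʳ w)) (cong [_]ᵇ (<ᵇ-suc w)))
path-closerʳ (suc k) (suc i) = cong₂ _+_ (cong [_]ᵇ (suc-<ᵇ i)) (path-closerʳ k i)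

closer-path : ∀ k i → i < k → closerB (4 + k) (4 + i) (5 + i) ≡ 5 + i
closer-path k i i<k rewrite <ᵇ-suc i = cong (4 +_) (path-closerˡ k i i<k)

closer-path′ : ∀ k i → closerB (4 + k) (5 + i) (4 + i) ≡ k ∸ suc i
closer-path′ k i rewrite suc-<ᵇ i = path-closerʳ k i

∑<-pick : ∀ k m (F : ℕ → ℕ) → ∑< k (λ j → if j ≡ᵇ m then F j else 0) ≡ (if m <ᵇ k then F m else 0)
∑<-pick zero    m       F = refl
∑<-pick (suc k) zero    F = trans (cong (F 0 +_) (∑<-0 k (λ _ → refl))) (+-identityʳ (F 0))
∑<-pick (suc k) (suc m) F = ∑<-pick k m (F ∘ suc)

path-adjacent : ∀ i j (x : ℕ) →
  (if i <ᵇ j then (if adjB (4 + i) (4 + j) then x else 0) else 0) ≡ (if j ≡ᵇ suc i then x else 0)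
path-adjacent i j x with j ≟ suc i
... | yes refl rewrite <ᵇ-suc i | does-intro (5 + i ≟ 5 + i) refl | dec-true (i ≟ i) refl = refl
... | no j≢ = trans (vanish (i <ᵇ j) (λ i<j → ≢true⇒≡false (nonadjacent i<j)))
                    (sym (cong (λ b → if b then x else 0) (dec-false (j ≟ suc i) j≢)))
  where
  vanish : ∀ b {c} → (b ≡ true → c ≡ false) → (if b then (if c then x else 0) else 0) ≡ 0
  vanish false _  = refl
  vanish true  c≡ = cong (λ c → if c then x else 0) (c≡ refl)
  nonadjacent : (i <ᵇ j) ≡ true → adjB (4 + i) (4 + j) ≢ true
  nonadjacent i<j e with ∨-elim (bE (4 + i) (4 + j)) e
  ... | inj₁ e₁ = j≢ (+-cancelˡ-≡ 4 _ _ (does-elim (4 + j ≟ 5 + i) e₁))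
  ... | inj₂ e₂ with refl ← +-cancelˡ-≡ 4 i (suc j) (does-elim (4 + i ≟ 5 + j) e₂)
                with () ← trans (sym i<j) (suc-<ᵇ j)

-- The offset `c` is general because shifting the index in the induction raises it by one.
∑<-path : ∀ c k → ∑< (suc k) (λ i → (c + i) * (k ∸ i)) ≡ c * tri (suc k) + tet k
∑<-path c zero    = trans (cong (_+ 0) (*-zeroʳ (c + 0))) (sym (cong (_+ 0) (*-zeroʳ c)))
∑<-path c (suc k) = trans
  (cong₂ _+_ (cong (_* suc k) (+-identityʳ c))
    (trans (∑<-cong (suc k) (λ i → cong (_* (k ∸ i)) (+-suc c i))) (∑<-path (suc c) k)))
  (lemma c k (tri k) (tet k))
  where
  lemma : ∀ c k t T → c * suc k + (suc c * (k + t) + T) ≡ c * (suc k + (k + t)) + (k + t + T)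
  lemma = solve-∀

Szeged-path : ∀ k → ∑pairs< (suc k) (λ i j → termB (5 + k) (4 + i) (4 + j)) ≡ 5 * tri (suc k) + tet k
Szeged-path k = trans (∑<-cong (suc k) row) (∑<-path 5 k)
  where
  N = 5 + k
  F : ℕ → ℕ → ℕ
  F i j = closerB N (4 + i) (4 + j) * closerB N (4 + j) (4 + i)
  row : ∀ i → ∑< (suc k) (λ j → if i <ᵇ j then termB N (4 + i) (4 + j) else 0) ≡ (5 + i) * (k ∸ i)
  row i = trans (∑<-cong (suc k) (λ j → path-adjacent i j (F i j))) (trans (∑<-pick (suc k) (suc i) (F i)) value)
    where
    value : (if i <ᵇ k then F i (suc i) else 0) ≡ (5 + i) * (k ∸ i)
    value with i <? k
    ... | yes i<k rewrite dec-true (i <? k) i<k = cong₂ _*_ (closer-path (suc k) i (m≤n⇒m≤1+n i<k)) (closer-path′ (suc k) i)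
    -- The last path vertex has no successor; the factor `k ∸ i` vanishes there, so the formula
    -- holds for the whole range.
    ... | no i≮k rewrite dec-false (i <? k) i≮k | m≤n⇒m∸n≡0 (≮⇒≥ i≮k) = sym (*-zeroʳ (5 + i))

Wiener-path : ∀ k → ∑pairs< k ∣_-_∣ ≡ tet k
Wiener-path zero    = refl
Wiener-path (suc k) = cong₂ _+_ (trans (∑<-suc k (λ j → j)) (cong (k +_) (∑<-id k))) (Wiener-path k)

Wiener-B : ∀ k → ∑pairs< (4 + k) distB ≡ diamondWiener (2 + k)
Wiener-B k = trans (cong₂ (λ r s → 3 + r + (2 + s + (2 + s + (s + ∑pairs< k ∣_-_∣)))) r₁ r₂)
  (trans (cong (λ s → 3 + (k + tri k) + (2 + (k + (k + tri k)) + (2 + (k + (k + tri k)) + (k + (k + tri k) + s)))) (Wiener-path k))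
         (lemma k (tri k) (tet k)))
  where
  r₁ : ∑< k suc ≡ k + tri k
  r₁ = trans (∑<-suc k (λ j → j)) (cong (k +_) (∑<-id k))
  r₂ : ∑< k (λ j → 2 + j) ≡ k + (k + tri k)
  r₂ = trans (∑<-suc k suc) (cong (k +_) r₁)
  lemma : ∀ k t T → 3 + (k + t) + (2 + (k + (k + t)) + (2 + (k + (k + t)) + (k + (k + t) + T))) ≡
                    2 + suc (suc k + (k + t)) + (suc (suc k + (k + t)) + (suc k + (k + t) + (k + t + T)))
  lemma = solve-∀

Szeged-B : ∀ k → ∑pairs< (5 + k) (termB (5 + k)) ≡ 2 + diamondWiener (3 + k)
Szeged-B k = trans (cong₂ _+_ row₀ (cong₂ _+_ row₁ (cong₂ _+_ (zeros (suc k)) (cong₂ _+_ (zeros (suc k)) (Szeged-path k)))))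
                   (lemma k (tri k) (tet k))
  where
  N = 5 + k
  zeros : ∀ m → ∑< m (λ _ → 0) ≡ 0
  zeros m = ∑<-0 m (λ _ → refl)
  row₀ : ∑< N (λ q → if 0 <ᵇ q then termB N 0 q else 0) ≡
         (2 + k) * 1 + ((3 + k) * 1 + ((3 + k) * 1 + (4 * suc k + 0)))
  row₀ = cong₂ _+_ (cong₂ _*_ (closer-01 (suc k)) (closer-10 (suc k)))
    (cong₂ _+_ (cong₂ _*_ (closer-02 (suc k)) (closer-20 (suc k)))
      (cong₂ _+_ (cong₂ _*_ (closer-03 (suc k)) (closer-30 (suc k)))
        (cong₂ _+_ (cong₂ _*_ (closer-04 (suc k)) (closer-40 (suc k))) (zeros k))))
  row₁ : ∑< N (λ q → if 1 <ᵇ q then termB N 1 q else 0) ≡ 2 * 1 + (2 * 1 + 0)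
  row₁ = cong₂ _+_ (cong₂ _*_ (closer-12 (suc k)) (closer-21 (suc k)))
    (cong₂ _+_ (cong₂ _*_ (closer-13 (suc k)) (closer-31 (suc k))) (zeros (suc k)))
  lemma : ∀ k t T →
    (2 + k) * 1 + ((3 + k) * 1 + ((3 + k) * 1 + (4 * suc k + 0))) + (4 + (0 + (0 + (5 * (k + t) + T)))) ≡
    2 + (2 + suc (2 + k + (1 + k + (k + t))) + (suc (2 + k + (1 + k + (k + t))) +
         (2 + k + (1 + k + (k + t)) + (1 + k + (k + t) + (k + t + T)))))
  lemma = solve-∀

-- From the excess to the ratio

halve-≤ : ∀ {i j} → i + i ≤ j + j → i ≤ j
halve-≤ le = ≮⇒≥ λ j<i → <⇒≱ (+-mono-< j<i j<i) le

excess-halved : ∀ s w {t} m → s + s ≡ w + w + t → m + m ≤ t → w + m ≤ s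
excess-halved s w m eq le = halve-≤ (≤-trans (≤-reflexive (lemma w m)) (≤-trans (+-monoʳ-≤ (w + w) le) (≤-reflexive (sym eq))))
  where
  lemma : ∀ w m → w + m + (w + m) ≡ w + w + (m + m)
  lemma = solve-∀

-- The ratio bound multiplied out, with 12 split as 3 · 4: the three units of excess are weighed
-- against 4w.
ratio-strict : ∀ s w D → w + 3 ≤ s → 4 * w < D → w * (D + 12) < s * D
ratio-strict s w D le lt = begin-strict
  w * (D + 12)          ≡⟨ expand w D ⟩
  w * D + 3 * (4 * w)   <⟨ +-monoʳ-< (w * D) (*-monoʳ-< 3 lt) ⟩
  w * D + 3 * D         ≡⟨ *-distribʳ-+ D w 3 ⟨
  (w + 3) * D           ≤⟨ *-monoˡ-≤ D le ⟩
  s * D                 ∎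
  where
  open ≤-Reasoning
  expand : ∀ w D → w * (D + 12) ≡ w * D + 3 * (4 * w)
  expand = solve-∀

module _ (s w D : ℕ) (le : w + 2 ≤ s) where

  private
    expand : ∀ w D → w * (D + 12) ≡ w * D + 2 * (6 * w)
    expand = solve-∀

    lower : w * D + 2 * D ≤ s * D
    lower = ≤-trans (≤-reflexive (sym (*-distribʳ-+ D w 2))) (*-monoˡ-≤ D le)

  -- Here 12 is split as 2 · 6. All losses vanish only if `D` equals 6w.
  ratio-≤ : 6 * w ≤ D → w * (D + 12) ≤ s * D
  ratio-≤ small = ≤-trans (≤-reflexive (expand w D)) (≤-trans (+-monoʳ-≤ (w * D) (*-monoʳ-≤ 2 small)) lower)

  ratio-tight : s * D ≡ w * (D + 12) → D ≤ 6 * w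
  ratio-tight eq = *-cancelˡ-≤ 2 (+-cancelˡ-≤ (w * D) _ _ (≤-trans lower (≤-reflexive (trans eq (expand w D)))))

4*tet<den : ∀ {n} → 5 ≤ n → 4 * tet n < den n
4*tet<den (s≤s (s≤s (s≤s (s≤s (s≤s {n = j} z≤n))))) = begin-strict
  4 * tet (2 + m)                                    ≡⟨ expand m (tri m) (tet m) ⟩
  2 * (6 * m) + (4 + 8 * tri m + 4 * tet m)          <⟨ +-monoˡ-< _ (*-monoʳ-< 2 (growth j)) ⟩
  2 * (10 + 2 * tri m + tet m) + (4 + 8 * tri m + 4 * tet m)
                                                     ≡⟨ collect (tri m) (tet m) ⟩
  6 * diamondWiener m                                ≡⟨ den-diamondWiener m ⟨
  den (2 + m)                                        ∎
  where
  open ≤-Reasoning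
  m = 3 + j
  expand : ∀ m t T → 4 * (suc m + (m + t) + (m + t + T)) ≡ 2 * (6 * m) + (4 + 8 * t + 4 * T)
  expand = solve-∀
  collect : ∀ t T → 2 * (10 + 2 * t + T) + (4 + 8 * t + 4 * T) ≡ 6 * (2 + suc t + (suc t + T))
  collect = solve-∀
  -- What remains after cancelling common terms with m = n - 2; it starts at n = 5 as 18 < 20.
  growth : ∀ j → 6 * (3 + j) < 10 + 2 * tri (3 + j) + tet (3 + j)
  growth zero    = m≤m+n 19 1
  growth (suc j) = begin-strict
    6 * (4 + j)                                                  ≡⟨ *-suc 6 (3 + j) ⟩
    6 + 6 * (3 + j)                                              <⟨ +-monoʳ-< 6 (growth j) ⟩
    6 + (10 + 2 * tri (3 + j) + tet (3 + j))                     ≤⟨ m≤m+n _ _ ⟩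
    6 + (10 + 2 * tri (3 + j) + tet (3 + j)) + (3 + 3 * j + tri (3 + j))
                                                                 ≡⟨ step-up j (tri (3 + j)) (tet (3 + j)) ⟩
    10 + 2 * tri (4 + j) + tet (4 + j)                           ∎
    where
    step-up : ∀ j t T → 6 + (10 + 2 * t + T) + (3 + 3 * j + t) ≡ 10 + 2 * (3 + j + t) + (3 + j + t + T)
    step-up = solve-∀

lollipop-ratio : ∀ {n} → 5 ≤ n → {G : Graph n} → Connected G → G ≅ Badj n → Szeged G * den n ≡ Wiener G * (den n + 12)
lollipop-ratio {n} 5≤n@(s≤s (s≤s (s≤s (s≤s (s≤s {n = k} z≤n))))) {G} conn iso = begin
  Szeged G * den n                         ≡⟨ cong (_* den n) (trans (sz≡ 5≤n iso isD) (Szeged-B k)) ⟩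
  (2 + W) * den n                          ≡⟨ expand W (den n) ⟩
  W * den n + 2 * den n                    ≡⟨ cong (λ D → W * den n + 2 * D) (den-diamondWiener (3 + k)) ⟩
  W * den n + 2 * (6 * W)                  ≡⟨ collect W (den n) ⟩
  W * (den n + 12)                         ≡⟨ cong (_* (den n + 12)) (trans (wi≡ 5≤n iso isD) (Wiener-B (suc k))) ⟨
  Wiener G * (den n + 12)                  ∎
  where
  open ≡-Reasoning
  isD = dist-isDistance G conn
  W = diamondWiener (3 + k)
  expand : ∀ w D → (2 + w) * D ≡ w * D + 2 * D
  expand = solve-∀
  collect : ∀ w D → w * D + 2 * (6 * w) ≡ w * (D + 12)
  collect = solve-∀

theorem2p3 : ∀ (n : ℕ) → 5 ≤ n → (G : Graph n) → Connected G →
    (∃[ H ] (Block G H × NonComplete H)) →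
    (Wiener G * (den n + 12) ≤ Szeged G * den n) ×
    ((Szeged G * den n ≡ Wiener G * (den n + 12)) ⇔ (G ≅ Badj n))
theorem2p3 n 5≤n G conn (H , block , noncomplete)
  with Squares.outcome-diamond (dist-isDistance G conn) (noncomplete-outcome {H = H} (dist-isDistance G conn) block noncomplete)
... | inj₁ big = <⇒≤ strict , mk⇔ (λ eq → ⊥-elim (<-irrefl (sym eq) strict)) (lollipop-ratio 5≤n {G} conn)
  where
  open Excess (dist-isDistance G conn)
  strict : Wiener G * (den n + 12) < Szeged G * den n
  strict = ratio-strict sz wi (den n) (excess-halved sz wi 3 2sz≡2wi+total big)
    (≤-<-trans (*-monoʳ-≤ 4 (Wiener-bound conn (dist-isDistance G conn) (≤-trans (s≤s z≤n) 5≤n))) (4*tet<den 5≤n))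
... | inj₂ (four , x , y , a , b , D) = ratio-≤ sz wi (den n) sz≥ (proj₁ bound) ,
    -- Equality of the ratio gives `den n ≤ 6 * wi`, so the Wiener bound is attained and identifies
    -- the graph.
    mk⇔ (λ eq → proj₂ bound (≤-antisym (proj₁ bound) (ratio-tight sz wi (den n) sz≥ eq))) (lollipop-ratio 5≤n {G} conn)
  where
  open Excess (dist-isDistance G conn)
  bound = diamond-bound conn (dist-isDistance G conn) D 5≤n
  sz≥ : Wiener G + 2 ≤ Szeged G
  sz≥ = excess-halved sz wi 2 2sz≡2wi+total four
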